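{- For any recursive function $h:\omega\to\omega$, there exists $G:\omega\to\omega$ which is relatively $\mathsf{DNR}$ such that for each Turing functional $\Phi$ and each $i\in\omega$, $\Phi^{G_0\oplus\cdots\oplus G_i}$ is not an $h$-$\mathsf{DNR}$ function.
   Context: Let $(\Phi_n)_{n\in\omega}$ be a standard enumeration of Turing functionals. For $G:\omega\to\omega$ and $n\in\omega$, the $n$th column of $G$ is $G_n:\omega\to\omega$, $G_n(k)=G(2^n(2k+1))$; conversely $\oplus_n G_n$ denotes the function $G$ with $G(2^n(2k+1))=G_n(k)$, and $G_0\oplus\cdots\oplus G_{m}$ denotes the corresponding join of finitely many functions (for $m=-1$ it is the empty oracle). Given $H,G:\omega\to\omega$, $H$ is $\mathsf{DNR}^G$ if for all $x$, $\Phi^G_x(x)$ diverges or $H(x)\ne\Phi^G_x(x)$; $H$ is $\mathsf{DNR}$ if it is $\mathsf{DNR}^\emptyset$; $H$ is $h$-$\mathsf{DNR}$ if it is $\mathsf{DNR}$ and $H(n)<h(n)$ for all $n$. A function $G:\omega\to\omega$ is called relatively $\mathsf{DNR}$ if there are no $x,y\in\omega$ with $G_{2y}(x)=\Phi_x^{G_0\oplus\cdots\oplus G_{2y-1}}(x)$ (for $y=0$ the oracle is empty). -}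

module Defs where

open import Data.Nat using (ℕ; zero; suc; _+_; _*_; _^_; _<_; _<ᵇ_; _%_; _/_)
open import Data.Fin using (Fin; toℕ)
open import Data.Vec using (Vec; []; _∷_; lookup)
open import Data.Bool using (Bool; true; false; if_then_else_)
open import Data.Product using (Σ; _×_; _,_)
open import Relation.Binary.PropositionalEquality using (_≡_; _≢_)
open import Relation.Nullary using (¬_)

-- A concrete model of oracle computation: partial recursive functionals
-- (Kleene's schemes relativised to a total oracle G : ℕ → ℕ).
-- Code n = programs of arity n.

data Code : ℕ → Set where
  zer  : ∀ {n} → Code n
  succ : Code 1
  proj : ∀ {n} → Fin n → Code n
  orc  : Code 1
  comp : ∀ {m n} → Code m → Vec (Code n) m → Code n
  prec : ∀ {n} → Code n → Code (suc (suc n)) → Code (suc n)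
  mu   : ∀ {n} → Code (suc n) → Code n

mutual
  data _⊢_[_]⇓_ (G : ℕ → ℕ) : ∀ {n} → Code n → Vec ℕ n → ℕ → Set where
    ev-zer  : ∀ {n} {xs : Vec ℕ n} → G ⊢ zer [ xs ]⇓ 0
    ev-succ : ∀ {x} → G ⊢ succ [ x ∷ [] ]⇓ suc x
    ev-proj : ∀ {n} {i : Fin n} {xs} → G ⊢ proj i [ xs ]⇓ lookup xs i
    ev-orc  : ∀ {x} → G ⊢ orc [ x ∷ [] ]⇓ G x
    ev-comp : ∀ {m n} {c : Code m} {ds : Vec (Code n) m} {xs ys y} →
              G ⊢ ds [ xs ]⇓* ys → G ⊢ c [ ys ]⇓ y → G ⊢ comp c ds [ xs ]⇓ y
    ev-prz  : ∀ {n} {f : Code n} {g} {xs y} →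
              G ⊢ f [ xs ]⇓ y → G ⊢ prec f g [ 0 ∷ xs ]⇓ y
    ev-prs  : ∀ {n} {f : Code n} {g} {k xs r y} →
              G ⊢ prec f g [ k ∷ xs ]⇓ r → G ⊢ g [ k ∷ r ∷ xs ]⇓ y →
              G ⊢ prec f g [ suc k ∷ xs ]⇓ y
    ev-mu   : ∀ {n} {f : Code (suc n)} {xs k} →
              G ⊢ f [ k ∷ xs ]⇓ 0 →
              (∀ j → j < k → Σ ℕ λ y → G ⊢ f [ j ∷ xs ]⇓ suc y) →
              G ⊢ mu f [ xs ]⇓ k

  data _⊢_[_]⇓*_ (G : ℕ → ℕ) : ∀ {m n} → Vec (Code n) m → Vec ℕ n → Vec ℕ m → Set where
    ev-[] : ∀ {n} {xs : Vec ℕ n} → G ⊢ [] [ xs ]⇓* []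
    ev-∷  : ∀ {m n} {d : Code n} {ds : Vec (Code n) m} {xs y ys} →
            G ⊢ d [ xs ]⇓ y → G ⊢ ds [ xs ]⇓* ys → G ⊢ (d ∷ ds) [ xs ]⇓* (y ∷ ys)

-- Gödel numbering of programs (injective), giving the enumeration Φ_e.

pair : ℕ → ℕ → ℕ
pair a b = 2 ^ a * (2 * b + 1)

mutual
  encode : ∀ {n} → Code n → ℕ
  encode {n} c = pair n (body c)

  body : ∀ {n} → Code n → ℕ
  body zer         = pair 0 0
  body succ        = pair 1 0
  body (proj i)    = pair 2 (toℕ i)
  body orc         = pair 3 0
  body (comp c ds) = pair 4 (pair (encode c) (encodeVec ds))
  body (prec f g)  = pair 5 (pair (encode f) (encode g))
  body (mu f)      = pair 6 (encode f)

  encodeVec : ∀ {m n} → Vec (Code n) m → ℕ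
  encodeVec []       = 0
  encodeVec (d ∷ ds) = suc (pair (encode d) (encodeVec ds))

-- Φ e G x ⇓ y :  Φ_e^G(x) converges with value y.
-- (Indices not of the form encode c denote the nowhere-defined functional.)
Φ_[_]_⇓_ : ℕ → (ℕ → ℕ) → ℕ → ℕ → Set
Φ e [ G ] x ⇓ y = Σ (Code 1) λ c → (encode c ≡ e) × (G ⊢ c [ x ∷ [] ]⇓ y)

∅ : ℕ → ℕ
∅ _ = 0

Recursive : (ℕ → ℕ) → Set
Recursive h = Σ ℕ λ e → ∀ n → Φ e [ ∅ ] n ⇓ h n

column : (ℕ → ℕ) → ℕ → ℕ → ℕ
column G n k = G (2 ^ n * (2 * k + 1))

-- 2-adic valuation of x (for x ≥ 1), computed with fuel.
v2-fuel : ℕ → ℕ → ℕ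
v2-fuel zero    x = 0
v2-fuel (suc f) zero = 0
v2-fuel (suc f) (suc x) with (suc x) % 2
... | zero  = suc (v2-fuel f ((suc x) / 2))
... | suc _ = 0

v2 : ℕ → ℕ
v2 x = v2-fuel x x

-- initJoin m G = G_0 ⊕ ⋯ ⊕ G_{m-1} (the join of the first m columns of G):
-- value G_n(k) at 2^n(2k+1) for n < m, and 0 elsewhere.  initJoin 0 G = ∅.
initJoin : ℕ → (ℕ → ℕ) → ℕ → ℕ
initJoin m G zero    = 0
initJoin m G (suc x) = if v2 (suc x) <ᵇ m then G (suc x) else 0

DNR^ : (H G : ℕ → ℕ) → Set
DNR^ H G = ∀ x y → Φ x [ G ] x ⇓ y → H x ≢ y

DNR : (ℕ → ℕ) → Set
DNR H = DNR^ H ∅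

_-DNR_ : (h H : ℕ → ℕ) → Set
h -DNR H = DNR H × (∀ n → H n < h n)

RelativelyDNR : (ℕ → ℕ) → Set
RelativelyDNR G = ∀ x y → ¬ (Φ x [ initJoin (2 * y) G ] x ⇓ column G (2 * y) x)

IsHDNRVia : (h : ℕ → ℕ) → ℕ → (ℕ → ℕ) → Set
IsHDNRVia h e X = Σ (ℕ → ℕ) λ H → (∀ x → Φ e [ X ] x ⇓ H x) × (h -DNR H)

{-# OPTIONS --safe #-}

-- Forcing with bushy trees, one column at a time.  Suppose X computes no h-DNR function.
-- A condition is a string σ with a set B of bad strings that is k-small above σ, i.e. no finite
-- k-branching tree above σ has all its leaves in B; initially B consists of the strings that are
-- not DNR relative to X, which is 2-small.  Given a functional Φ, let A x v be the set of strings
-- τ with Φ^(X ⊕ τ)(x) = v.  If for some x all A x v with v < h x are k-small, then adding them to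
-- B keeps it small and prevents Φ^(X ⊕ G)(x) from converging below h x.  Otherwise for every x
-- some A x v is k-big, and since bigness is Σ₁ in X, X computes f with A x (f x) k-big for all x.
-- As f is not h-DNR, some x has f x ≥ h x or f x = Φ_x(x); since A x (f x) is k-big and B is not,
-- σ extends to some τ in A x (f x) above which B is still k-small.  The generic G is DNR relative
-- to X, and X ⊕ G again computes no h-DNR function, so the construction can be iterated from
-- X = ∅, which computes no DNR function at all.

module Submission where

open import Defs
open import Level using (0ℓ)
open import Axiom.ExcludedMiddle using (ExcludedMiddle)
open import Data.Bool using (true; false; T)
open import Data.Empty using (⊥-elim)
open import Data.Fin using (Fin; zero; suc; toℕ)
open import Data.Fin.Properties using (toℕ-injective)
open import Data.List using (List; []; _∷_; length; _++_)
open import Data.List.Membership.Propositional using (_∈_)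
open import Data.List.Membership.Propositional.Properties using (∈-++⁺ˡ; ∈-++⁺ʳ)
open import Data.List.Relation.Unary.Any using (here; there)
open import Data.Nat
open import Data.Nat.DivMod using ([m+kn]%n≡m%n; m*n%n≡0; m*n/n≡m)
open import Data.Nat.Properties
open import Data.Product using (Σ; _×_; _,_; proj₁; proj₂)
open import Data.Sum as Sum using (_⊎_; inj₁; inj₂)
open import Data.Unit using (⊤; tt)
open import Data.Vec using (Vec; []; _∷_; lookup; head; tail; map; tabulate)
open import Function using (_∘_; id)
open import Relation.Binary.Definitions using (tri<; tri≈; tri>)
open import Relation.Binary.PropositionalEquality
open import Relation.Nullary using (¬_; yes; no)

-- The pairing function of the Gödel numbering

pair-zero : ∀ b → pair 0 b ≡ suc (2 * b)
pair-zero b = trans (*-identityˡ _) (+-comm (2 * b) 1)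

pair-suc : ∀ a b → pair (suc a) b ≡ 2 * pair a b
pair-suc a b = *-assoc 2 (2 ^ a) _

pair-injective : ∀ a a′ b b′ → pair a b ≡ pair a′ b′ → a ≡ a′ × b ≡ b′
pair-injective zero zero b b′ eq =
  refl , *-cancelˡ-≡ b b′ 2 (suc-injective (trans (sym (pair-zero b)) (trans eq (pair-zero b′))))
pair-injective zero (suc a′) b b′ eq =
  ⊥-elim (even≢odd (pair a′ b′) b (trans (sym (pair-suc a′ b′)) (trans (sym eq) (pair-zero b))))
pair-injective (suc a) zero b b′ eq =
  ⊥-elim (even≢odd (pair a b) b′ (trans (sym (pair-suc a b)) (trans eq (pair-zero b′))))
pair-injective (suc a) (suc a′) b b′ eq
  with pair-injective a a′ b b′ (*-cancelˡ-≡ (pair a b) (pair a′ b′) 2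
         (trans (sym (pair-suc a b)) (trans eq (pair-suc a′ b′))))
... | refl , b≡b′ = refl , b≡b′

InColumn : ℕ → ℕ → Set
InColumn n q = Σ ℕ λ k → q ≡ pair n k

-- The bound is harmless since k < pair n k, and keeps the condition decidable.
OffColumn : ℕ → ℕ → Set
OffColumn n q = ∀ k → k < suc q → q ≢ pair n k

even-or-odd : ∀ x → Σ ℕ λ q → x ≡ 2 * q ⊎ x ≡ suc (2 * q)
even-or-odd zero = 0 , inj₁ refl
even-or-odd (suc x) with even-or-odd x
... | q , inj₁ refl = q , inj₂ refl
... | q , inj₂ refl = suc q , inj₁ (cong suc (sym (+-suc q (q + 0))))

pair-surjective : ∀ x → x ≢ 0 → Σ ℕ λ n → InColumn n x
pair-surjective x = go x x ≤-refl
  where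
  go : ∀ f x → x ≤ f → x ≢ 0 → Σ ℕ λ n → InColumn n x
  go zero zero z≤n x≢0 = ⊥-elim (x≢0 refl)
  go (suc f) x x≤f x≢0 with even-or-odd x
  ... | q , inj₂ eq = 0 , q , trans eq (sym (pair-zero q))
  ... | zero , inj₁ eq = ⊥-elim (x≢0 eq)
  ... | suc q , inj₁ refl
    with go f (suc q) (≤-trans (s≤s (m≤m+n q 0)) (≤-trans (m≤n+m (suc (q + 0)) q) (s≤s⁻¹ x≤f))) (λ ())
  ...   | n , k , eq = suc n , k , trans (cong (2 *_) eq) (sym (pair-suc n k))

pair≢0 : ∀ n k → pair n k ≢ 0
pair≢0 zero    k eq = 0≢1+n (trans (sym eq) (pair-zero k))
pair≢0 (suc n) k eq = pair≢0 n k (m+n≡0⇒m≡0 _ (trans (sym (pair-suc n k)) eq))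

k<pair : ∀ n k → k < pair n k
k<pair zero    k = ≤-trans (s≤s (m≤m+n k (k + 0))) (≤-reflexive (sym (pair-zero k)))
k<pair (suc n) k = ≤-trans (k<pair n k) (≤-trans (m≤m+n _ _) (≤-reflexive (sym (pair-suc n k))))

v2-fuel-odd : ∀ f q → v2-fuel (suc f) (suc (2 * q)) ≡ 0
v2-fuel-odd f q with suc (2 * q) % 2 | trans (cong (λ u → suc u % 2) (*-comm 2 q)) ([m+kn]%n≡m%n 1 q 2)
... | .1 | refl = refl

v2-fuel-even : ∀ f q → v2-fuel (suc f) (2 * suc q) ≡ suc (v2-fuel f (suc q))
v2-fuel-even f q with (2 * suc q) % 2 | trans (cong (_% 2) (*-comm 2 (suc q))) (m*n%n≡0 (suc q) 2)
... | .0 | refl = cong (suc ∘ v2-fuel f) (trans (cong (_/ 2) (*-comm 2 (suc q))) (m*n/n≡m (suc q) 2))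

v2-pair : ∀ n k → v2 (pair n k) ≡ n
v2-pair n k = go n (pair n k) ≤-refl
  where
  -- Any fuel that is at least the argument suffices, because every halving strictly decreases the
  -- argument.
  go : ∀ n f → pair n k ≤ f → v2-fuel f (pair n k) ≡ n
  go n zero le = ⊥-elim (pair≢0 n k (n≤0⇒n≡0 le))
  go zero (suc f) le = trans (cong (v2-fuel (suc f)) (pair-zero k)) (v2-fuel-odd f k)
  go (suc n) (suc f) le with pair n k in eq | pair-suc n k | go n f
  ... | zero  | _    | _  = ⊥-elim (pair≢0 n k eq)
  ... | suc q | eq′ | ih rewrite eq′ = trans (v2-fuel-even f q)
    (cong suc (ih (≤-trans (s≤s (m≤m+n q 0)) (≤-trans (m≤n+m (suc (q + 0)) q) (s≤s⁻¹ le)))))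

-- Programs

-- Splitting `body` uniformly into constructor number and arguments lets injectivity treat all
-- constructors with one call to `pair-injective`; unequal tags rule out the mixed cases.
tag : ∀ {n} → Code n → ℕ
tag zer         = 0
tag succ        = 1
tag (proj _)    = 2
tag orc         = 3
tag (comp _ _)  = 4
tag (prec _ _)  = 5
tag (mu _)      = 6

payload : ∀ {n} → Code n → ℕ
payload zer         = 0
payload succ        = 0
payload (proj i)    = toℕ i
payload orc         = 0
payload (comp c ds) = pair (encode c) (encodeVec ds)
payload (prec f g)  = pair (encode f) (encode g)
payload (mu f)      = encode f

body-pair : ∀ {n} (c : Code n) → body c ≡ pair (tag c) (payload c)
body-pair zer        = refl
body-pair succ       = refl
body-pair (proj _)   = refl
body-pair orc        = refl
body-pair (comp _ _) = refl
body-pair (prec _ _) = refl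
body-pair (mu _)     = refl

mutual
  encode-injective : ∀ {n} (c d : Code n) → encode c ≡ encode d → c ≡ d
  encode-injective {n} c d eq
    with pair-injective (tag c) (tag d) (payload c) (payload d) (trans (sym (body-pair c))
           (trans (proj₂ (pair-injective n n (body c) (body d) eq)) (body-pair d)))
  ... | t , p = payload-injective c d t p

  payload-injective : ∀ {n} (c d : Code n) → tag c ≡ tag d → payload c ≡ payload d → c ≡ d
  payload-injective zer zer _ _ = refl
  payload-injective succ succ _ _ = refl
  payload-injective (proj i) (proj j) _ eq = cong proj (toℕ-injective eq)
  payload-injective orc orc _ _ = refl
  payload-injective (comp {m} c ds) (comp {m′} c′ ds′) refl eq
    with pair-injective (encode c) (encode c′) (encodeVec ds) (encodeVec ds′) eq
  -- `comp` hides its inner arity, but `encode c` stores it as a first component, so the two arities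
  -- agree before the programs are compared.
  ... | eq₁ , eq₂ with proj₁ (pair-injective m m′ (body c) (body c′) eq₁)
  ... | refl = cong₂ comp (encode-injective c c′ eq₁) (encodeVec-injective ds ds′ eq₂)
  payload-injective (prec f g) (prec f′ g′) refl eq
    with pair-injective (encode f) (encode f′) (encode g) (encode g′) eq
  ... | eq₁ , eq₂ = cong₂ prec (encode-injective f f′ eq₁) (encode-injective g g′ eq₂)
  payload-injective (mu f) (mu f′) refl eq = cong mu (encode-injective f f′ eq)

  encodeVec-injective : ∀ {m n} (ds es : Vec (Code n) m) → encodeVec ds ≡ encodeVec es → ds ≡ es
  encodeVec-injective [] [] _ = refl
  encodeVec-injective (d ∷ ds) (e ∷ es) eq
    with pair-injective (encode d) (encode e) (encodeVec ds) (encodeVec es) (suc-injective eq)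
  ... | eq₁ , eq₂ = cong₂ _∷_ (encode-injective d e eq₁) (encodeVec-injective ds es eq₂)

mutual
  ⇓-deterministic : ∀ {G n} {c : Code n} {xs y z} → G ⊢ c [ xs ]⇓ y → G ⊢ c [ xs ]⇓ z → y ≡ z
  ⇓-deterministic ev-zer ev-zer = refl
  ⇓-deterministic ev-succ ev-succ = refl
  ⇓-deterministic ev-proj ev-proj = refl
  ⇓-deterministic ev-orc ev-orc = refl
  ⇓-deterministic (ev-comp p q) (ev-comp p′ q′) with ⇓*-deterministic p p′
  ... | refl = ⇓-deterministic q q′
  ⇓-deterministic (ev-prz p) (ev-prz p′) = ⇓-deterministic p p′
  ⇓-deterministic (ev-prs p q) (ev-prs p′ q′) with ⇓-deterministic p p′
  ... | refl = ⇓-deterministic q q′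
  ⇓-deterministic (ev-mu {k = k} p q) (ev-mu {k = k′} p′ q′) with <-cmp k k′
  -- At the smaller of two distinct answers `f` would return both 0 and a successor.
  ... | tri< k<k′ _ _ = ⊥-elim (0≢1+n (⇓-deterministic p (proj₂ (q′ k k<k′))))
  ... | tri≈ _ k≡k′ _ = k≡k′
  ... | tri> _ _ k′<k = ⊥-elim (0≢1+n (sym (⇓-deterministic (proj₂ (q k′ k′<k)) p′)))

  ⇓*-deterministic : ∀ {G m n} {ds : Vec (Code n) m} {xs ys zs} →
                     G ⊢ ds [ xs ]⇓* ys → G ⊢ ds [ xs ]⇓* zs → ys ≡ zs
  ⇓*-deterministic ev-[] ev-[] = refl
  ⇓*-deterministic (ev-∷ p ps) (ev-∷ q qs) =
    cong₂ _∷_ (⇓-deterministic p q) (⇓*-deterministic ps qs)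

Φ-deterministic : ∀ {e G x y z} → Φ e [ G ] x ⇓ y → Φ e [ G ] x ⇓ z → y ≡ z
Φ-deterministic {e} (c , eq , p) (d , eq′ , q) with encode-injective c d (trans eq (sym eq′))
... | refl = ⇓-deterministic p q

-- Evaluation with partial oracles and the use principle

Iter : (ℕ → Set) → (ℕ → ℕ → ℕ → Set) → ℕ → ℕ → Set
Iter base step zero    y = base y
Iter base step (suc k) y = Σ ℕ λ r → Iter base step k r × step k r y

mutual
  -- Evaluation with a partial oracle, given by its graph.
  Ev : (ℕ → ℕ → Set) → ∀ {n} → Code n → Vec ℕ n → ℕ → Set
  Ev P zer xs y = y ≡ 0
  Ev P succ xs y = y ≡ suc (head xs)
  Ev P (proj i) xs y = y ≡ lookup xs i
  Ev P orc xs y = P (head xs) y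
  Ev P (comp {m} c ds) xs y = Σ (Vec ℕ m) λ ys → Evs P ds xs ys × Ev P c ys y
  Ev P (prec f g) xs y = Iter (Ev P f (tail xs)) (λ k r → Ev P g (k ∷ r ∷ tail xs)) (head xs) y
  Ev P (mu f) xs y = Ev P f (y ∷ xs) 0 × (∀ j → j < y → Σ ℕ λ z → Ev P f (j ∷ xs) (suc z))

  Evs : (ℕ → ℕ → Set) → ∀ {m n} → Vec (Code n) m → Vec ℕ n → Vec ℕ m → Set
  Evs P []       xs ys = ⊤
  Evs P (d ∷ ds) xs ys = Ev P d xs (head ys) × Evs P ds xs (tail ys)

module _ {P : ℕ → ℕ → Set} {G : ℕ → ℕ} (P⊆G : ∀ q a → P q a → G q ≡ a) where
  mutual
    -- Every query answered by `P` gets the same answer from `G`, so the computation carries over to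
    -- any total extension of `P`.
    Ev⇒⇓ : ∀ {n} (c : Code n) xs y → Ev P c xs y → G ⊢ c [ xs ]⇓ y
    Ev⇒⇓ zer xs y refl = ev-zer
    Ev⇒⇓ succ (x ∷ []) y refl = ev-succ
    Ev⇒⇓ (proj i) xs y refl = ev-proj
    Ev⇒⇓ orc (x ∷ []) y p with P⊆G x y p
    ... | refl = ev-orc
    Ev⇒⇓ (comp c ds) xs y (ys , p , q) = ev-comp (Evs⇒⇓* ds xs ys p) (Ev⇒⇓ c ys y q)
    Ev⇒⇓ (prec f g) (k ∷ xs) y p = go k y p
      where
      go : ∀ k y → Iter (Ev P f xs) (λ k r → Ev P g (k ∷ r ∷ xs)) k y → G ⊢ prec f g [ k ∷ xs ]⇓ y
      go zero    y p           = ev-prz (Ev⇒⇓ f xs y p)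
      go (suc k) y (r , p , q) = ev-prs (go k r p) (Ev⇒⇓ g _ y q)
    Ev⇒⇓ (mu f) xs y (p , q) =
      ev-mu (Ev⇒⇓ f _ 0 p) λ j j<y → proj₁ (q j j<y) , Ev⇒⇓ f _ _ (proj₂ (q j j<y))

    Evs⇒⇓* : ∀ {m n} (ds : Vec (Code n) m) xs ys → Evs P ds xs ys → G ⊢ ds [ xs ]⇓* ys
    Evs⇒⇓* []       xs []       _       = ev-[]
    Evs⇒⇓* (d ∷ ds) xs (y ∷ ys) (p , q) = ev-∷ (Ev⇒⇓ d xs y p) (Evs⇒⇓* ds xs ys q)

-- Asking for all large `s` lets finitely many queries be combined by a maximum, with no
-- monotonicity of the approximations in `s`.
Eventually : (ℕ → Set) → Set
Eventually Q = Σ ℕ λ m → ∀ s → m ≤ s → Q s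

eventually-pure : ∀ {Q : ℕ → Set} → (∀ s → Q s) → Eventually Q
eventually-pure q = 0 , λ s _ → q s

eventually-zip : ∀ {Q R S : ℕ → Set} → (∀ s → Q s → R s → S s) → Eventually Q → Eventually R → Eventually S
eventually-zip f (m , q) (n , r) =
  m ⊔ n , λ s le → f s (q s (m⊔n≤o⇒m≤o m n le)) (r s (m⊔n≤o⇒n≤o m n le))

eventually-all< : ∀ b (Q : ℕ → ℕ → Set) → (∀ j → j < b → Eventually (λ s → Q s j)) →
                  Eventually (λ s → ∀ j → j < b → Q s j)
eventually-all< zero    Q f = 0 , λ _ _ _ ()
eventually-all< (suc b) Q f =
  eventually-zip combine (eventually-all< b Q (λ j j<b → f j (m≤n⇒m≤1+n j<b))) (f b (n<1+n b))
  where
  combine : ∀ s → (∀ j → j < b → Q s j) → Q s b → ∀ j → j < suc b → Q s j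
  combine s below top j j<1+b with m≤n⇒m<n∨m≡n (s≤s⁻¹ j<1+b)
  ... | inj₁ j<b  = below j j<b
  ... | inj₂ refl = top

-- The use principle, for finite approximations P s of the oracle G.
module _ {P : ℕ → ℕ → ℕ → Set} {G : ℕ → ℕ} (G⊆P : ∀ q → Eventually (λ s → P s q (G q))) where
  mutual
    ⇓⇒Ev : ∀ {n} (c : Code n) {xs y} → G ⊢ c [ xs ]⇓ y → Eventually (λ s → Ev (P s) c xs y)
    ⇓⇒Ev zer ev-zer = eventually-pure λ _ → refl
    ⇓⇒Ev succ ev-succ = eventually-pure λ _ → refl
    ⇓⇒Ev (proj i) ev-proj = eventually-pure λ _ → refl
    ⇓⇒Ev orc (ev-orc {x}) = G⊆P x
    ⇓⇒Ev (comp c ds) (ev-comp {ys = ys} p q) =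
      eventually-zip (λ _ u v → ys , u , v) (⇓*⇒Evs ds p) (⇓⇒Ev c q)
    ⇓⇒Ev (prec f g) {k ∷ xs} p = go k p
      where
      go : ∀ k {y} → G ⊢ prec f g [ k ∷ xs ]⇓ y →
           Eventually (λ s → Iter (Ev (P s) f xs) (λ k r → Ev (P s) g (k ∷ r ∷ xs)) k y)
      go zero    (ev-prz p)           = ⇓⇒Ev f p
      go (suc k) (ev-prs {r = r} p q) = eventually-zip (λ _ u v → r , u , v) (go k p) (⇓⇒Ev g q)
    ⇓⇒Ev (mu f) {xs} {y} (ev-mu p q) = eventually-zip (λ _ → _,_) (⇓⇒Ev f p)
      (eventually-all< y (λ s j → Σ ℕ λ z → Ev (P s) f (j ∷ xs) (suc z)) λ j j<y →
        let (z , r) = q j j<y in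
        eventually-zip (λ _ u _ → z , u) (⇓⇒Ev f r) (eventually-pure {λ _ → ⊤} λ _ → tt))

    ⇓*⇒Evs : ∀ {m n} (ds : Vec (Code n) m) {xs ys} → G ⊢ ds [ xs ]⇓* ys → Eventually (λ s → Evs (P s) ds xs ys)
    ⇓*⇒Evs []       ev-[]      = eventually-pure λ _ → tt
    ⇓*⇒Evs (d ∷ ds) (ev-∷ p q) = eventually-zip (λ _ → _,_) (⇓⇒Ev d p) (⇓*⇒Evs ds q)

-- Pointwise equality cannot be substituted without extensionality; instead the computation passes
-- through `Ev`, with the graph of `H` as every approximation of `G`.
⇓-cong : ∀ {G H} → (∀ q → G q ≡ H q) → ∀ {n} {c : Code n} {xs y} → G ⊢ c [ xs ]⇓ y → H ⊢ c [ xs ]⇓ y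
⇓-cong {G} {H} G≗H {c = c} p =
  let (m , ev) = ⇓⇒Ev {P = λ _ q a → H q ≡ a} (λ q → 0 , λ _ _ → sym (G≗H q)) c p in
  Ev⇒⇓ (λ _ _ → id) c _ _ (ev m ≤-refl)

-- Bushy trees

-- Listing the elements in increasing order makes them distinct.
data Many (P : ℕ → Set) : ℕ → ℕ → Set where
  none : ∀ {l} → Many P l 0
  more : ∀ {l k} x → l ≤ x → P x → Many P (suc x) k → Many P l (suc k)

many-weaken : ∀ {P l l′ k} → l ≤ l′ → Many P l′ k → Many P l k
many-weaken l≤l′ none             = none
many-weaken l≤l′ (more x l≤x p m) = more x (≤-trans l≤l′ l≤x) p m

many-map : ∀ {P Q : ℕ → Set} → (∀ x → P x → Q x) → ∀ {l k} → Many P l k → Many Q l k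
many-map f none             = none
many-map f (more x l≤x p m) = more x l≤x (f x p) (many-map f m)

many-all : ∀ {P : ℕ → Set} → (∀ x → P x) → ∀ l k → Many P l k
many-all p l zero    = none
many-all p l (suc k) = more l ≤-refl (p l) (many-all p (suc l) k)

-- Pigeonhole: each listed element lowers the demand `m` or the demand `n` by one, and the list is
-- long enough to exhaust one of them.
many-split : ∀ {P Q : ℕ → Set} m n {l} → Many (λ x → P x ⊎ Q x) l (m + n) → Many P l m ⊎ Many Q l n
many-split zero    n       _                       = inj₁ none
many-split (suc m) n       (more x l≤x (inj₁ p) r) with many-split m n r
... | inj₁ s = inj₁ (more x l≤x p s)
... | inj₂ s = inj₂ (many-weaken (m≤n⇒m≤1+n l≤x) s)
many-split (suc m) zero    _                       = inj₂ none
many-split {P} {Q} (suc m) (suc n) (more x l≤x (inj₂ q) r)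
  with many-split (suc m) n (subst (Many _ (suc x)) (+-suc m n) r)
... | inj₁ s = inj₁ (many-weaken (m≤n⇒m≤1+n l≤x) s)
... | inj₂ s = inj₂ (more x l≤x q s)

-- Strings are reversed lists: the last entry of the string comes first.
Str : Set
Str = List ℕ

data _⊑_ (σ : Str) : Str → Set where
  ⊑-refl : σ ⊑ σ
  ⊑-step : ∀ {x τ} → σ ⊑ τ → σ ⊑ (x ∷ τ)

⊑-trans : ∀ {ρ σ τ} → ρ ⊑ σ → σ ⊑ τ → ρ ⊑ τ
⊑-trans p ⊑-refl     = p
⊑-trans p (⊑-step q) = ⊑-step (⊑-trans p q)

⊑-length : ∀ {σ τ} → σ ⊑ τ → length σ ≤ length τ
⊑-length ⊑-refl     = ≤-refl
⊑-length (⊑-step p) = m≤n⇒m≤1+n (⊑-length p)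

-- A derivation is itself the finite tree: it is well-founded, and each inner node lists `k`
-- distinct children.
data Big (k : ℕ) (A : Str → Set) (σ : Str) : Set where
  leaf : A σ → Big k A σ
  node : Many (λ x → Big k A (x ∷ σ)) 0 k → Big k A σ

mutual
  -- Labels move from the leaves to the root: among `m + n` labelled children, `m` carry the first
  -- label or `n` the second.
  big-split : ∀ {A B : Str → Set} m n {σ} → Big (m + n) (λ τ → A τ ⊎ B τ) σ → Big m A σ ⊎ Big n B σ
  big-split m n (leaf (inj₁ a)) = inj₁ (leaf a)
  big-split m n (leaf (inj₂ b)) = inj₂ (leaf b)
  big-split m n (node bs) = Sum.map node node (many-split m n (big-splits m n bs))

  big-splits : ∀ {A B : Str → Set} m n {σ l k} → Many (λ x → Big (m + n) (λ τ → A τ ⊎ B τ) (x ∷ σ)) l k →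
               Many (λ x → Big m A (x ∷ σ) ⊎ Big n B (x ∷ σ)) l k
  big-splits m n none             = none
  big-splits m n (more x l≤x b r) = more x l≤x (big-split m n b) (big-splits m n r)

mutual
  -- A tree for `B` is grafted onto each leaf of the tree for `A`.
  big-concat : ∀ {A B : Str → Set} {k σ} → Big k A σ → (∀ τ → σ ⊑ τ → A τ → Big k B τ) → Big k B σ
  big-concat (leaf a)  f = f _ ⊑-refl a
  big-concat (node bs) f = node (big-concats bs f)

  big-concats : ∀ {A B : Str → Set} {k σ l j} → Many (λ x → Big k A (x ∷ σ)) l j →
                (∀ τ → σ ⊑ τ → A τ → Big k B τ) → Many (λ x → Big k B (x ∷ σ)) l j
  big-concats none             f = none
  big-concats (more x l≤x b r) f =
    more x l≤x (big-concat b λ τ p → f τ (⊑-trans (⊑-step ⊑-refl) p)) (big-concats r f)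

big-map : ∀ {A B : Str → Set} {k σ} → (∀ τ → A τ → B τ) → Big k A σ → Big k B σ
big-map f b = big-concat b λ τ _ a → leaf (f τ a)

small-∪ : ∀ {A B : Str → Set} {m n σ} → ¬ Big m A σ → ¬ Big n B σ → ¬ Big (m + n) (λ τ → A τ ⊎ B τ) σ
small-∪ {m = m} {n} ¬a ¬b ab with big-split m n ab
... | inj₁ a = ¬a a
... | inj₂ b = ¬b b

-- Each added set costs another `k` in branching, so only finitely many can be absorbed; this is
-- where the bound `h x` on the values enters.
small-⋃ : ∀ {B : Str → Set} {A : ℕ → Str → Set} {k σ} b → ¬ Big k B σ → (∀ v → v < b → ¬ Big k (A v) σ) →
          Σ ℕ λ k′ → ¬ Big k′ (λ τ → B τ ⊎ Σ ℕ λ v → v < b × A v τ) σ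
small-⋃ {k = k} zero ¬b ¬a = k , ¬b ∘ big-map λ { _ (inj₁ b) → b }
small-⋃ {B} {A} {k} (suc b) ¬b ¬a with small-⋃ b ¬b (λ v v<b → ¬a v (m≤n⇒m≤1+n v<b))
... | k′ , ¬u = k′ + k , small-∪ ¬u (¬a b (n<1+n b)) ∘ big-map regroup
  where
  regroup : ∀ τ → B τ ⊎ (Σ ℕ λ v → v < suc b × A v τ) → (B τ ⊎ Σ ℕ λ v → v < b × A v τ) ⊎ A b τ
  regroup τ (inj₁ p) = inj₁ (inj₁ p)
  regroup τ (inj₂ (v , v<1+b , a)) with m≤n⇒m<n∨m≡n (s≤s⁻¹ v<1+b)
  ... | inj₁ v<b  = inj₁ (inj₂ (v , v<b , a))
  ... | inj₂ refl = inj₂ a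

-- Arithmetic coding

-- (a , b) is coded by (a + b)² + a, so decoding only needs an integer square root.
⟪_,_⟫ : ℕ → ℕ → ℕ
⟪ a , b ⟫ = (a + b) * (a + b) + a

-- The root grows by one exactly when the next square has been reached. Truncated subtraction
-- performs this test, which makes the definition a primitive recursion.
√ : ℕ → ℕ
√ zero    = 0
√ (suc n) = √ n + (1 ∸ (suc (√ n) * suc (√ n) ∸ suc n))

fst : ℕ → ℕ
fst z = z ∸ √ z * √ z

snd : ℕ → ℕ
snd z = √ z ∸ fst z

√-bounds : ∀ n → √ n * √ n ≤ n × n < suc (√ n) * suc (√ n)
√-bounds zero = z≤n , s≤s z≤n
√-bounds (suc n) with √ n | √-bounds n
... | r | lo , hi with suc r * suc r ≤? suc n
...   | yes p rewrite m≤n⇒m∸n≡0 p | +-comm r 1 =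
  p , (begin-strict
    suc n ≤⟨ hi ⟩
    suc r * suc r <⟨ *-mono-< (n<1+n (suc r)) (n<1+n (suc r)) ⟩
    suc (suc r) * suc (suc r) ∎)
  where open ≤-Reasoning
...   | no ¬p rewrite m≤n⇒m∸n≡0 {1} (m<n⇒0<n∸m (≰⇒> ¬p)) | +-identityʳ r =
  m≤n⇒m≤1+n lo , ≰⇒> ¬p

√-unique : ∀ m n → m * m ≤ n → n < suc m * suc m → √ n ≡ m
√-unique m n lo hi with √-bounds n
... | lo′ , hi′ = ≤-antisym
  (≮⇒≥ λ m<√ → <-irrefl refl (≤-<-trans (≤-trans (*-mono-≤ m<√ m<√) lo′) hi))
  (≮⇒≥ λ √<m → <-irrefl refl (≤-<-trans (≤-trans (*-mono-≤ √<m √<m) lo) hi′))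

-- The summand `a` is at most `a + b`, which is too small to reach the next square.
√-⟪⟫ : ∀ a b → √ ⟪ a , b ⟫ ≡ a + b
√-⟪⟫ a b = √-unique (a + b) _ (m≤m+n _ a) (begin-strict
  (a + b) * (a + b) + a         ≤⟨ +-monoʳ-≤ ((a + b) * (a + b)) (m≤m+n a b) ⟩
  (a + b) * (a + b) + (a + b)   ≡⟨ +-comm _ (a + b) ⟩
  suc (a + b) * (a + b)         <⟨ *-monoʳ-< (suc (a + b)) (n<1+n (a + b)) ⟩
  suc (a + b) * suc (a + b)     ∎)
  where open ≤-Reasoning

fst-⟪⟫ : ∀ a b → fst ⟪ a , b ⟫ ≡ a
fst-⟪⟫ a b rewrite √-⟪⟫ a b = m+n∸m≡n ((a + b) * (a + b)) a

snd-⟪⟫ : ∀ a b → snd ⟪ a , b ⟫ ≡ b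
snd-⟪⟫ a b rewrite fst-⟪⟫ a b | √-⟪⟫ a b = m+n∸m≡n a b

infix 9 _‼_
-- Every number is read as an infinite sequence, so lookup is total and lengths are recorded
-- separately.
_‼_ : ℕ → ℕ → ℕ
w ‼ zero  = fst w
w ‼ suc i = snd w ‼ i

-- `prec` keeps its parameters fixed, whereas `‼` changes the sequence as it recurses; iterating
-- `snd` from the outside has the required form.
sndⁿ : ℕ → ℕ → ℕ
sndⁿ zero    w = w
sndⁿ (suc i) w = snd (sndⁿ i w)

sndⁿ-snd : ∀ i w → sndⁿ i (snd w) ≡ snd (sndⁿ i w)
sndⁿ-snd zero    w = refl
sndⁿ-snd (suc i) w = cong snd (sndⁿ-snd i w)

fst-sndⁿ : ∀ i w → fst (sndⁿ i w) ≡ w ‼ i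
fst-sndⁿ zero    w = refl
fst-sndⁿ (suc i) w = trans (cong fst (sym (sndⁿ-snd i w))) (fst-sndⁿ i (snd w))

-- Finite choice inside one number: it supplies the single witness of a bounded universal
-- quantifier.
collect : ∀ n (Q : ℕ → ℕ → Set) → (∀ i → i < n → Σ ℕ (Q i)) → Σ ℕ λ w → ∀ i → i < n → Q i (w ‼ i)
collect zero    Q f = 0 , λ _ ()
collect (suc n) Q f with f 0 (s≤s z≤n) | collect n (Q ∘ suc) (λ i i<n → f (suc i) (s≤s i<n))
... | s , q | w , qs = ⟪ s , w ⟫ , λ where
  zero    _         → subst (Q 0) (sym (fst-⟪⟫ s w)) q
  (suc i) (s≤s i<n) → subst (λ u → Q (suc i) (u ‼ i)) (sym (snd-⟪⟫ s w)) (qs i i<n)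

unpack : ∀ m → ℕ → Vec ℕ m
unpack zero    w = []
unpack (suc m) w = fst w ∷ unpack m (snd w)

pack : ∀ {m} → Vec ℕ m → ℕ
pack []       = 0
pack (y ∷ ys) = ⟪ y , pack ys ⟫

unpack-pack : ∀ {m} (ys : Vec ℕ m) → unpack m (pack ys) ≡ ys
unpack-pack []       = refl
unpack-pack (y ∷ ys) = cong₂ _∷_ (fst-⟪⟫ y (pack ys)) (trans (cong (unpack _) (snd-⟪⟫ y (pack ys))) (unpack-pack ys))

-- Positions count from the start of the string, so the head of the list has position `length τ`.
-- Beyond the end the default is 0.
entry : Str → ℕ → ℕ
entry []      k = 0
entry (x ∷ τ) k with k ≟ length τ
... | yes _ = x
... | no  _ = entry τ k

entry-last : ∀ x τ → entry (x ∷ τ) (length τ) ≡ x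
entry-last x τ with length τ ≟ length τ
... | yes _ = refl
... | no ¬p = ⊥-elim (¬p refl)

entry-init : ∀ x τ {k} → k < length τ → entry (x ∷ τ) k ≡ entry τ k
entry-init x τ {k} k< with k ≟ length τ
... | yes refl = ⊥-elim (<-irrefl refl k<)
... | no _     = refl

entry-⊑ : ∀ {σ τ} → σ ⊑ τ → ∀ {k} → k < length σ → entry τ k ≡ entry σ k
entry-⊑ ⊑-refl k< = refl
entry-⊑ (⊑-step {x} {τ} p) k< = trans (entry-init x τ (<-≤-trans k< (⊑-length p))) (entry-⊑ p k<)

-- A coded string carries its length, so that entries can be addressed from the start.
push : ℕ → ℕ → ℕ
push t x = ⟪ suc (fst t) , ⟪ x , snd t ⟫ ⟫

enc : Str → ℕ
enc []      = ⟪ 0 , 0 ⟫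
enc (x ∷ τ) = push (enc τ) x

fst-enc : ∀ τ → fst (enc τ) ≡ length τ
fst-enc []      = refl
fst-enc (x ∷ τ) = trans (fst-⟪⟫ (suc (fst (enc τ))) _) (cong suc (fst-enc τ))

-- The code lists the last entry first; `i + suc k ≡ length τ` translates a position from the end
-- into one from the start without subtraction.
snd-enc : ∀ τ i k → i + suc k ≡ length τ → snd (enc τ) ‼ i ≡ entry τ k
snd-enc [] i k eq with trans (sym (+-suc i k)) eq
... | ()
snd-enc (x ∷ τ) zero k refl rewrite snd-⟪⟫ (suc (fst (enc τ))) ⟪ x , snd (enc τ) ⟫ =
  trans (fst-⟪⟫ x (snd (enc τ))) (sym (entry-last x τ))
snd-enc (x ∷ τ) (suc i) k eq rewrite snd-⟪⟫ (suc (fst (enc τ))) ⟪ x , snd (enc τ) ⟫ =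
  trans (cong (_‼ i) (snd-⟪⟫ x (snd (enc τ))))
    (trans (snd-enc τ i k eq′) (sym (entry-init x τ (≤-trans (m≤n+m (suc k) i) (≤-reflexive eq′)))))
  where
  eq′ : i + suc k ≡ length τ
  eq′ = suc-injective eq

-- w lists the intermediate values of a recursion, the last one first.
Trace : (ℕ → Set) → (ℕ → ℕ → ℕ → Set) → ℕ → ℕ → ℕ → Set
Trace base step k y w = w ‼ 0 ≡ y × base (w ‼ k) ×
  (∀ i → i < k → Σ ℕ λ j → i + suc j ≡ k × step j (w ‼ suc i) (w ‼ i))

Trace⇒Iter : ∀ {base step} k {y} w → Trace base step k y w → Iter base step k y
Trace⇒Iter zero    w (refl , b , _) = b
Trace⇒Iter (suc k) w (refl , b , f) with f 0 (s≤s z≤n)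
... | j , refl , s = snd w ‼ 0
  , Trace⇒Iter k (snd w) (refl , b , λ i i<k →
      let (j , eq , s) = f (suc i) (s≤s i<k) in j , suc-injective eq , s)
  , s

Iter⇒Trace : ∀ {base step} k {y} → Iter base step k y → Σ ℕ (Trace base step k y)
Iter⇒Trace {base} zero {y} b = ⟪ y , 0 ⟫ , fst-⟪⟫ y 0 , subst base (sym (fst-⟪⟫ y 0)) b , λ _ ()
Iter⇒Trace {base} {step} (suc k) {y} (r , p , s) with Iter⇒Trace k p
... | w , refl , b , f = ⟪ y , w ⟫ , fst-⟪⟫ y w , subst (λ u → base (u ‼ k)) (sym (snd-⟪⟫ y w)) b , steps
  where
  steps : ∀ i → i < suc k → Σ ℕ λ j → i + suc j ≡ suc k × step j (snd ⟪ y , w ⟫ ‼ i) (⟪ y , w ⟫ ‼ i)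
  steps zero _ = k , refl , subst₂ (step k) (cong (_‼ 0) (sym (snd-⟪⟫ y w))) (sym (fst-⟪⟫ y w)) s
  steps (suc i) (s≤s i<k) with f i i<k
  ... | j , eq , s′ =
    j , cong suc eq , subst (λ u → step j (u ‼ suc i) (u ‼ i)) (sym (snd-⟪⟫ y w)) s′

-- Bigness is Σ₁ because a finite list of coded strings certifies it; children occur further
-- down the list, so that soundness is an induction on the position.
Certificate : ℕ → (ℕ → Set) → ℕ → ℕ → Set
Certificate k A w m = ∀ i → i < m →
  A (w ‼ i) ⊎ Many (λ x → Σ ℕ λ j → i < j × j < m × w ‼ j ≡ push (w ‼ i) x) 0 k

-- Induction on `d`, which bounds the number of positions from `i` on; a child sits at some `j > i`,
-- so a smaller bound serves for it.
Certificate⇒Big : ∀ {k} A {w m} → Certificate k A w m → ∀ d i → m ≤ i + d → i < m →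
                  ∀ τ → w ‼ i ≡ enc τ → Big k (A ∘ enc) τ
Certificate⇒Big A cert zero i m≤i i<m τ eq =
  ⊥-elim (<-irrefl refl (<-≤-trans i<m (≤-trans m≤i (≤-reflexive (+-identityʳ i)))))
Certificate⇒Big A cert (suc d) i m≤i+d i<m τ eq with cert i i<m
... | inj₁ a  = leaf (subst A eq a)
... | inj₂ ch = node (many-map (λ x (j , i<j , j<m , eq′) →
        Certificate⇒Big A cert d j
          (≤-trans m≤i+d (≤-trans (≤-reflexive (+-suc i d)) (+-monoˡ-≤ d i<j)))
          j<m (x ∷ τ) (trans eq′ (cong (λ u → push u x) eq))) ch)

-- Certificates as lists: membership in the remaining list replaces comparison of positions, and
-- certificates of subtrees can simply be concatenated.
Closed : ℕ → (ℕ → Set) → List ℕ → Set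
Closed k A []       = ⊤
Closed k A (t ∷ ts) = (A t ⊎ Many (λ x → push t x ∈ ts) 0 k) × Closed k A ts

Closed-++ : ∀ {k A} ts {us} → Closed k A ts → Closed k A us → Closed k A (ts ++ us)
Closed-++ []       _        d = d
Closed-++ (t ∷ ts) (inj₁ a , c) d = inj₁ a , Closed-++ ts c d
Closed-++ (t ∷ ts) (inj₂ m , c) d = inj₂ (many-map (λ _ → ∈-++⁺ˡ) m) , Closed-++ ts c d

mutual
  -- The tree is listed in preorder, so every node precedes its children.
  Big⇒Closed : ∀ {k} A {σ} → Big k (A ∘ enc) σ → Σ (List ℕ) λ ts → Closed k A (enc σ ∷ ts)
  Big⇒Closed A (leaf a) = [] , inj₁ a , tt
  Big⇒Closed A (node bs) with Bigs⇒Closed A bs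
  ... | ts , c , m = ts , inj₂ m , c

  Bigs⇒Closed : ∀ {k} A {σ l j} → Many (λ x → Big k (A ∘ enc) (x ∷ σ)) l j →
                Σ (List ℕ) λ ts → Closed k A ts × Many (λ x → push (enc σ) x ∈ ts) l j
  Bigs⇒Closed A none = [] , tt , none
  Bigs⇒Closed A {σ} (more x l≤x b bs) with Big⇒Closed A b | Bigs⇒Closed A bs
  ... | ts , c | us , d , m = (push (enc σ) x ∷ ts) ++ us , Closed-++ (push (enc σ) x ∷ ts) c d
    , more x l≤x (here refl) (many-map (λ _ → ∈-++⁺ʳ (push (enc σ) x ∷ ts)) m)

encList : List ℕ → ℕ
encList []       = 0
encList (t ∷ ts) = ⟪ t , encList ts ⟫

encList-∈ : ∀ {t} ts → t ∈ ts → Σ ℕ λ j → j < length ts × encList ts ‼ j ≡ t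
encList-∈ (t ∷ ts) (here refl) = 0 , s≤s z≤n , fst-⟪⟫ t (encList ts)
encList-∈ (t ∷ ts) (there p) with encList-∈ ts p
... | j , j< , eq = suc j , s≤s j< , trans (cong (_‼ j) (snd-⟪⟫ t (encList ts))) eq

Closed⇒Certificate : ∀ {k} A ts → Closed k A ts → Certificate k A (encList ts) (length ts)
Closed⇒Certificate A (t ∷ ts) (inj₁ a , c) zero _ = inj₁ (subst A (sym (fst-⟪⟫ t (encList ts))) a)
Closed⇒Certificate A (t ∷ ts) (inj₂ m , c) zero _ = inj₂ (many-map child m)
  where
  child : ∀ x → push t x ∈ ts → Σ ℕ λ j → 0 < j × j < suc (length ts) ×
          encList (t ∷ ts) ‼ j ≡ push (encList (t ∷ ts) ‼ 0) x
  child x p with encList-∈ ts p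
  ... | j , j< , eq = suc j , s≤s z≤n , s≤s j< , trans (cong (_‼ j) (snd-⟪⟫ t (encList ts)))
    (trans eq (cong (λ u → push u x) (sym (fst-⟪⟫ t (encList ts)))))
Closed⇒Certificate {k} A (t ∷ ts) (_ , c) (suc i) (s≤s i<) =
  subst (λ u → A (u ‼ i) ⊎ Many (λ x → Σ ℕ λ j → suc i < j × j < suc (length ts) ×
                 encList (t ∷ ts) ‼ j ≡ push (u ‼ i) x) 0 k)
    (sym (snd-⟪⟫ t (encList ts)))
    (Sum.map₂ (many-map λ x (j , i<j , j< , eq) → suc j , s≤s i<j , s≤s j< ,
        trans (cong (_‼ j) (snd-⟪⟫ t (encList ts))) eq)
      (Closed⇒Certificate A ts c i i<))

-- Relations that are Σ₁ in X

module Computability (X : ℕ → ℕ) where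

  -- Keeping the function beside its program lets relations be stated about ordinary arithmetic,
  -- while the program is assembled by the combinators.
  record Fun (N : ℕ) : Set where
    field
      ⟦_⟧  : Vec ℕ N → ℕ
      code : Code N
      ok   : ∀ ρ → X ⊢ code [ ρ ]⇓ ⟦_⟧ ρ
  open Fun public

  record Map (N m : ℕ) : Set where
    field
      ⟦_⟧*  : Vec ℕ N → Vec ℕ m
      codes : Vec (Code N) m
      ok*   : ∀ ρ → X ⊢ codes [ ρ ]⇓* ⟦_⟧* ρ
  open Map public

  infixr 5 _∷ᴹ_
  infixr 9 _∘ᶠ_ _∘ᴹ_

  _∘ᶠ_ : ∀ {N m} → Fun m → Map N m → Fun N
  f ∘ᶠ μ = record
    { ⟦_⟧  = λ ρ → ⟦ f ⟧ (⟦ μ ⟧* ρ)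
    ; code = comp (code f) (codes μ)
    ; ok   = λ ρ → ev-comp (ok* μ ρ) (ok f (⟦ μ ⟧* ρ)) }

  []ᴹ : ∀ {N} → Map N 0
  []ᴹ = record { ⟦_⟧* = λ _ → [] ; codes = [] ; ok* = λ _ → ev-[] }

  _∷ᴹ_ : ∀ {N m} → Fun N → Map N m → Map N (suc m)
  f ∷ᴹ μ = record
    { ⟦_⟧*  = λ ρ → ⟦ f ⟧ ρ ∷ ⟦ μ ⟧* ρ
    ; codes = code f ∷ codes μ
    ; ok*   = λ ρ → ev-∷ (ok f ρ) (ok* μ ρ) }

  ⇓*-map-comp : ∀ {N m n} {ds : Vec (Code N) m} {es : Vec (Code n) N} {ρ σ τ} →
                X ⊢ es [ ρ ]⇓* σ → X ⊢ ds [ σ ]⇓* τ → X ⊢ map (λ d → comp d es) ds [ ρ ]⇓* τ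
  ⇓*-map-comp p ev-[]      = ev-[]
  ⇓*-map-comp p (ev-∷ q r) = ev-∷ (ev-comp p q) (⇓*-map-comp p r)

  _∘ᴹ_ : ∀ {N m n} → Map m n → Map N m → Map N n
  ν ∘ᴹ μ = record
    { ⟦_⟧*  = λ ρ → ⟦ ν ⟧* (⟦ μ ⟧* ρ)
    ; codes = map (λ d → comp d (codes μ)) (codes ν)
    ; ok*   = λ ρ → ⇓*-map-comp (ok* μ ρ) (ok* ν (⟦ μ ⟧* ρ)) }

  ⇓*-projections : ∀ {N m} (ρ : Vec ℕ N) (ys : Vec ℕ m) (g : Fin m → Fin N) →
                   (∀ i → lookup ρ (g i) ≡ lookup ys i) → X ⊢ tabulate (proj ∘ g) [ ρ ]⇓* ys
  ⇓*-projections ρ []       g eq = ev-[]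
  ⇓*-projections ρ (y ∷ ys) g eq =
    ev-∷ (subst (X ⊢ proj (g zero) [ ρ ]⇓_) (eq zero) ev-proj) (⇓*-projections ρ ys (g ∘ suc) (eq ∘ suc))

  drop : ∀ {N} → Map (suc N) N
  drop = record
    { ⟦_⟧*  = tail
    ; codes = tabulate (proj ∘ suc)
    ; ok*   = λ { (s ∷ ρ) → ⇓*-projections (s ∷ ρ) ρ suc (λ _ → refl) } }

  idᴹ : ∀ {N} → Map N N
  idᴹ = record
    { ⟦_⟧*  = id
    ; codes = tabulate proj
    ; ok*   = λ ρ → ⇓*-projections ρ ρ id (λ _ → refl) }

  ⇓*-uncons : ∀ {N m} {ds : Vec (Code N) (suc m)} {ρ ys} →
              X ⊢ ds [ ρ ]⇓* ys → X ⊢ head ds [ ρ ]⇓ head ys × X ⊢ tail ds [ ρ ]⇓* tail ys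
  ⇓*-uncons (ev-∷ p q) = p , q

  headᴹ : ∀ {N m} → Map N (suc m) → Fun N
  headᴹ μ = record { ⟦_⟧ = head ∘ ⟦ μ ⟧* ; code = head (codes μ) ; ok = proj₁ ∘ ⇓*-uncons ∘ ok* μ }

  tailᴹ : ∀ {N m} → Map N (suc m) → Map N m
  tailᴹ μ = record { ⟦_⟧* = tail ∘ ⟦ μ ⟧* ; codes = tail (codes μ) ; ok* = proj₂ ∘ ⇓*-uncons ∘ ok* μ }

  ⇓*-lookup : ∀ {N m} {ds : Vec (Code N) m} {ρ ys} → X ⊢ ds [ ρ ]⇓* ys →
              ∀ i → X ⊢ lookup ds i [ ρ ]⇓ lookup ys i
  ⇓*-lookup (ev-∷ p ps) zero    = p
  ⇓*-lookup (ev-∷ p ps) (suc i) = ⇓*-lookup ps i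

  lookupᴹ : ∀ {N m} → Map N m → Fin m → Fun N
  lookupᴹ μ i = record { ⟦_⟧ = λ ρ → lookup (⟦ μ ⟧* ρ) i ; code = lookup (codes μ) i
                       ; ok = λ ρ → ⇓*-lookup (ok* μ ρ) i }

  wk : ∀ {N} → Fun N → Fun (suc N)
  wk f = f ∘ᶠ drop

  v₀ : ∀ {N} → Fun (suc N)
  v₀ = record { ⟦_⟧ = head ; code = proj zero ; ok = λ { (_ ∷ _) → ev-proj } }

  v₁ : ∀ {N} → Fun (2 + N)
  v₁ = wk v₀

  sucᶠ : ∀ {N} → Fun N → Fun N
  sucᶠ f = record { ⟦_⟧ = suc ∘ ⟦ f ⟧ ; code = comp succ (code f ∷ [])
                  ; ok = λ ρ → ev-comp (ev-∷ (ok f ρ) ev-[]) ev-succ }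

  orcᶠ : ∀ {N} → Fun N → Fun N
  orcᶠ f = record { ⟦_⟧ = X ∘ ⟦ f ⟧ ; code = comp orc (code f ∷ [])
                ; ok = λ ρ → ev-comp (ev-∷ (ok f ρ) ev-[]) ev-orc }

  const : ∀ {N} → ℕ → Fun N
  const {N} k = record { ⟦_⟧ = λ _ → k ; code = numeral k ; ok = go k }
    where
    numeral : ℕ → Code N
    numeral zero    = zer
    numeral (suc k) = comp succ (numeral k ∷ [])
    go : ∀ k ρ → X ⊢ numeral k [ ρ ]⇓ k
    go zero    ρ = ev-zer
    go (suc k) ρ = ev-comp (ev-∷ (go k ρ) ev-[]) ev-succ

  record Op₂ (_∙_ : ℕ → ℕ → ℕ) : Set where
    field
      opCode : Code 2
      opOk   : ∀ a b → X ⊢ opCode [ a ∷ b ∷ [] ]⇓ (a ∙ b)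
  open Op₂

  lift₂ : ∀ {_∙_ N} → Op₂ _∙_ → Fun N → Fun N → Fun N
  lift₂ {_∙_} o f g = record
    { ⟦_⟧  = λ ρ → ⟦ f ⟧ ρ ∙ ⟦ g ⟧ ρ
    ; code = comp (opCode o) (code f ∷ code g ∷ [])
    ; ok   = λ ρ → ev-comp (ev-∷ (ok f ρ) (ev-∷ (ok g ρ) ev-[])) (opOk o (⟦ f ⟧ ρ) (⟦ g ⟧ ρ)) }

  +-op : Op₂ _+_
  +-op = record { opCode = prec (proj zero) (code (sucᶠ (v₁ {1}))) ; opOk = go }
    where
    go : ∀ a b → X ⊢ prec (proj zero) (code (sucᶠ (v₁ {1}))) [ a ∷ b ∷ [] ]⇓ (a + b)
    go zero    b = ev-prz ev-proj
    go (suc a) b = ev-prs (go a b) (ok (sucᶠ (v₁ {1})) (a ∷ _ ∷ b ∷ []))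

  infixl 6 _+ᶠ_ _∸ᶠ_
  infixl 7 _*ᶠ_

  _+ᶠ_ : ∀ {N} → Fun N → Fun N → Fun N
  _+ᶠ_ = lift₂ +-op

  *-op : Op₂ _*_
  *-op = record { opCode = prec zer (code step) ; opOk = go }
    where
    step : Fun 3
    step = wk v₁ +ᶠ v₁
    go : ∀ a b → X ⊢ prec zer (code step) [ a ∷ b ∷ [] ]⇓ (a * b)
    go zero    b = ev-prz ev-zer
    go (suc a) b = ev-prs (go a b) (ok step (a ∷ _ ∷ b ∷ []))

  _*ᶠ_ : ∀ {N} → Fun N → Fun N → Fun N
  _*ᶠ_ = lift₂ *-op

  predᶠ : ∀ {N} → Fun N → Fun N
  predᶠ f = record { ⟦_⟧ = pred ∘ ⟦ f ⟧ ; code = comp (prec zer (proj zero)) (code f ∷ [])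
                   ; ok = λ ρ → ev-comp (ev-∷ (ok f ρ) ev-[]) (go (⟦ f ⟧ ρ)) }
    where
    go : ∀ a → X ⊢ prec zer (proj zero) [ a ∷ [] ]⇓ pred a
    go zero    = ev-prz ev-zer
    go (suc a) = ev-prs (go a) ev-proj

  -- `prec` recurses on its first argument, and subtraction has to recurse on the subtrahend.
  flip-∸-op : Op₂ (λ b a → a ∸ b)
  flip-∸-op = record { opCode = prec (proj zero) (code step) ; opOk = go }
    where
    step : Fun 3
    step = predᶠ v₁
    go : ∀ b a → X ⊢ prec (proj zero) (code step) [ b ∷ a ∷ [] ]⇓ (a ∸ b)
    go zero    a = ev-prz ev-proj
    go (suc b) a = subst (X ⊢ prec (proj zero) (code step) [ suc b ∷ a ∷ [] ]⇓_) (pred[m∸n]≡m∸[1+n] a b)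
                     (ev-prs (go b a) (ok step (b ∷ _ ∷ a ∷ [])))

  _∸ᶠ_ : ∀ {N} → Fun N → Fun N → Fun N
  f ∸ᶠ g = lift₂ flip-∸-op g f

  √ᶠ : ∀ {N} → Fun N → Fun N
  √ᶠ f = record { ⟦_⟧ = √ ∘ ⟦ f ⟧ ; code = comp (prec zer (code step)) (code f ∷ [])
                ; ok = λ ρ → ev-comp (ev-∷ (ok f ρ) ev-[]) (go (⟦ f ⟧ ρ)) }
    where
    step : Fun 2
    step = v₁ +ᶠ (const 1 ∸ᶠ (sucᶠ v₁ *ᶠ sucᶠ v₁ ∸ᶠ sucᶠ v₀))
    go : ∀ a → X ⊢ prec zer (code step) [ a ∷ [] ]⇓ √ a
    go zero    = ev-prz ev-zer
    go (suc a) = ev-prs (go a) (ok step (a ∷ _ ∷ []))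

  fstᶠ sndᶠ : ∀ {N} → Fun N → Fun N
  fstᶠ f = f ∸ᶠ √ᶠ f *ᶠ √ᶠ f
  sndᶠ f = √ᶠ f ∸ᶠ fstᶠ f

  ⟪_,_⟫ᶠ : ∀ {N} → Fun N → Fun N → Fun N
  ⟪ f , g ⟫ᶠ = (f +ᶠ g) *ᶠ (f +ᶠ g) +ᶠ f

  flip-‼-op : Op₂ (λ i w → w ‼ i)
  flip-‼-op = record { opCode = code (fstᶠ iter) ; opOk = λ i w →
      subst (X ⊢ code (fstᶠ iter) [ i ∷ w ∷ [] ]⇓_) (fst-sndⁿ i w) (ok (fstᶠ iter) (i ∷ w ∷ [])) }
    where
    step : Fun 3
    step = sndᶠ v₁
    go : ∀ i w → X ⊢ prec (proj zero) (code step) [ i ∷ w ∷ [] ]⇓ sndⁿ i w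
    go zero    w = ev-prz ev-proj
    go (suc i) w = ev-prs (go i w) (ok step (i ∷ _ ∷ w ∷ []))
    iter : Fun 2
    iter = record { ⟦_⟧ = λ ρ → sndⁿ (head ρ) (head (tail ρ)) ; code = prec (proj zero) (code step)
                  ; ok = λ { (i ∷ w ∷ []) → go i w } }

  infixl 9 _‼ᶠ_
  _‼ᶠ_ : ∀ {N} → Fun N → Fun N → Fun N
  f ‼ᶠ g = lift₂ flip-‼-op g f

  unpackᴹ : ∀ {N} m → Fun N → Map N m
  unpackᴹ {N} m w = record { ⟦_⟧* = unpack m ∘ ⟦ w ⟧ ; codes = go m w ; ok* = go-ok m w }
    where
    go : ∀ m → Fun N → Vec (Code N) m
    go zero    w = []
    go (suc m) w = code (fstᶠ w) ∷ go m (sndᶠ w)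
    go-ok : ∀ m (w : Fun N) ρ → X ⊢ go m w [ ρ ]⇓* unpack m (⟦ w ⟧ ρ)
    go-ok zero    w ρ = ev-[]
    go-ok (suc m) w ρ = ev-∷ (ok (fstᶠ w) ρ) (go-ok m (sndᶠ w) ρ)

  -- As 0 means success, a sum of tests acts as a bounded conjunction.
  sumBelow : ℕ → (ℕ → ℕ) → ℕ
  sumBelow zero    t = 0
  sumBelow (suc n) t = sumBelow n t + t n

  sumBelow-≡0 : ∀ n t → sumBelow n t ≡ 0 → ∀ i → i < n → t i ≡ 0
  sumBelow-≡0 (suc n) t eq i i<1+n with m≤n⇒m<n∨m≡n (s≤s⁻¹ i<1+n)
  ... | inj₁ i<n  = sumBelow-≡0 n t (m+n≡0⇒m≡0 _ eq) i i<n
  ... | inj₂ refl = m+n≡0⇒n≡0 (sumBelow n t) eq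

  ≡0-sumBelow : ∀ n t → (∀ i → i < n → t i ≡ 0) → sumBelow n t ≡ 0
  ≡0-sumBelow zero    t z = refl
  ≡0-sumBelow (suc n) t z =
    cong₂ _+_ (≡0-sumBelow n t (λ i i<n → z i (m≤n⇒m≤1+n i<n))) (z n (n<1+n n))

  sumᶠ : ∀ {N} → Fun (suc N) → Fun N → Fun N
  sumᶠ {N} f b = total ∘ᶠ (b ∷ᴹ idᴹ)
    where
    step : Fun (2 + N)
    step = v₁ +ᶠ (f ∘ᶠ (v₀ ∷ᴹ drop ∘ᴹ drop))
    go : ∀ n ρ → X ⊢ prec zer (code step) [ n ∷ ρ ]⇓ sumBelow n (λ i → ⟦ f ⟧ (i ∷ ρ))
    go zero    ρ = ev-prz ev-zer
    go (suc n) ρ = ev-prs (go n ρ) (ok step (n ∷ _ ∷ ρ))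
    total : Fun (suc N)
    total = record { ⟦_⟧ = λ ρ → sumBelow (head ρ) (λ i → ⟦ f ⟧ (i ∷ tail ρ)) ; code = prec zer (code step)
                   ; ok = λ { (n ∷ ρ) → go n ρ } }

  -- The value 0 signals that s witnesses R ρ.
  record Sg {N : ℕ} (R : Vec ℕ N → Set) : Set where
    field
      test     : Fun (suc N)
      sound    : ∀ ρ s → ⟦ test ⟧ (s ∷ ρ) ≡ 0 → R ρ
      complete : ∀ ρ → R ρ → Σ ℕ λ s → ⟦ test ⟧ (s ∷ ρ) ≡ 0
  open Sg public

  Sg-resp : ∀ {N} {R S : Vec ℕ N → Set} → (∀ ρ → R ρ → S ρ) → (∀ ρ → S ρ → R ρ) → Sg R → Sg S
  Sg-resp to from r = record
    { test = test r ; sound = λ ρ s → to ρ ∘ sound r ρ s ; complete = λ ρ → complete r ρ ∘ from ρ }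

  Sg-sub : ∀ {N m} {R : Vec ℕ m → Set} → Sg R → (μ : Map N m) → Sg (λ ρ → R (⟦ μ ⟧* ρ))
  Sg-sub r μ = record
    { test     = test r ∘ᶠ (v₀ ∷ᴹ μ ∘ᴹ drop)
    ; sound    = λ ρ → sound r (⟦ μ ⟧* ρ)
    ; complete = λ ρ → complete r (⟦ μ ⟧* ρ) }

  Sg-≤ : ∀ {N} (f g : Fun N) → Sg (λ ρ → ⟦ f ⟧ ρ ≤ ⟦ g ⟧ ρ)
  Sg-≤ f g = record
    { test     = wk (f ∸ᶠ g)
    ; sound    = λ ρ _ → m∸n≡0⇒m≤n
    ; complete = λ ρ p → 0 , m≤n⇒m∸n≡0 p }

  -- A product vanishes as soon as one factor does, so one witness can be offered to both tests.
  Sg-∨ : ∀ {N} {R S : Vec ℕ N → Set} → Sg R → Sg S → Sg (λ ρ → R ρ ⊎ S ρ)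
  Sg-∨ {R = R} {S} r s = record { test = test r *ᶠ test s ; sound = sound′ ; complete = complete′ }
    where
    sound′ : ∀ ρ w → ⟦ test r ⟧ (w ∷ ρ) * ⟦ test s ⟧ (w ∷ ρ) ≡ 0 → R ρ ⊎ S ρ
    sound′ ρ w eq with m*n≡0⇒m≡0∨n≡0 (⟦ test r ⟧ (w ∷ ρ)) eq
    ... | inj₁ z = inj₁ (sound r ρ w z)
    ... | inj₂ z = inj₂ (sound s ρ w z)
    complete′ : ∀ ρ → R ρ ⊎ S ρ → Σ ℕ λ w → ⟦ test r ⟧ (w ∷ ρ) * ⟦ test s ⟧ (w ∷ ρ) ≡ 0
    complete′ ρ (inj₁ p) with complete r ρ p
    ... | w , z = w , cong (_* ⟦ test s ⟧ (w ∷ ρ)) z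
    complete′ ρ (inj₂ p) with complete s ρ p
    ... | w , z = w , trans (cong (⟦ test r ⟧ (w ∷ ρ) *_) z) (*-zeroʳ (⟦ test r ⟧ (w ∷ ρ)))

  -- The two conjuncts may need different witnesses, so the witness is a coded pair.
  Sg-∧ : ∀ {N} {R S : Vec ℕ N → Set} → Sg R → Sg S → Sg (λ ρ → R ρ × S ρ)
  Sg-∧ {R = R} {S} r s = record
    { test     = test r ∘ᶠ (fstᶠ v₀ ∷ᴹ drop) +ᶠ test s ∘ᶠ (sndᶠ v₀ ∷ᴹ drop)
    ; sound    = λ ρ w eq → sound r ρ (fst w) (m+n≡0⇒m≡0 _ eq)
                          , sound s ρ (snd w) (m+n≡0⇒n≡0 (⟦ test r ⟧ (fst w ∷ ρ)) eq)
    ; complete = complete′ }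
    where
    complete′ : ∀ ρ → R ρ × S ρ → Σ ℕ λ w → ⟦ test r ⟧ (fst w ∷ ρ) + ⟦ test s ⟧ (snd w ∷ ρ) ≡ 0
    complete′ ρ (p , q) with complete r ρ p | complete s ρ q
    ... | a , y | b , z = ⟪ a , b ⟫ , cong₂ _+_
      (trans (cong (λ u → ⟦ test r ⟧ (u ∷ ρ)) (fst-⟪⟫ a b)) y)
      (trans (cong (λ u → ⟦ test s ⟧ (u ∷ ρ)) (snd-⟪⟫ a b)) z)

  Sg-∃ : ∀ {N} {R : Vec ℕ N → ℕ → Set} → Sg (λ ρ → R (tail ρ) (head ρ)) → Sg (λ ρ → Σ ℕ (R ρ))
  Sg-∃ {R = R} r = record
    { test     = test r ∘ᶠ (fstᶠ v₀ ∷ᴹ sndᶠ v₀ ∷ᴹ drop)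
    ; sound    = λ ρ w eq → snd w , sound r (snd w ∷ ρ) (fst w) eq
    ; complete = complete′ }
    where
    complete′ : ∀ ρ → Σ ℕ (R ρ) → Σ ℕ λ w → ⟦ test r ⟧ (fst w ∷ snd w ∷ ρ) ≡ 0
    complete′ ρ (x , p) with complete r (x ∷ ρ) p
    ... | s , z = ⟪ s , x ⟫ ,
      trans (cong₂ (λ a b → ⟦ test r ⟧ (a ∷ b ∷ ρ)) (fst-⟪⟫ s x) (snd-⟪⟫ s x)) z

  Sg-∀< : ∀ {N} (b : Fun N) {R : Vec ℕ N → ℕ → Set} → Sg (λ ρ → R (tail ρ) (head ρ)) →
          Sg (λ ρ → ∀ i → i < ⟦ b ⟧ ρ → R ρ i)
  Sg-∀< b {R} r = record
    { test     = sumᶠ (test r ∘ᶠ (v₁ ‼ᶠ v₀ ∷ᴹ v₀ ∷ᴹ drop ∘ᴹ drop)) (wk b)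
    ; sound    = λ ρ w eq i i<b → sound r (i ∷ ρ) (w ‼ i) (sumBelow-≡0 (⟦ b ⟧ ρ) _ eq i i<b)
    ; complete = complete′ }
    where
    complete′ : ∀ ρ → (∀ i → i < ⟦ b ⟧ ρ → R ρ i) →
          Σ ℕ λ w → sumBelow (⟦ b ⟧ ρ) (λ i → ⟦ test r ⟧ (w ‼ i ∷ i ∷ ρ)) ≡ 0
    complete′ ρ p with collect (⟦ b ⟧ ρ) (λ i s → ⟦ test r ⟧ (s ∷ i ∷ ρ) ≡ 0) (λ i i<b → complete r (i ∷ ρ) (p i i<b))
    ... | w , z = w , ≡0-sumBelow (⟦ b ⟧ ρ) _ z

  Sg-≡ : ∀ {N} (f g : Fun N) → Sg (λ ρ → ⟦ f ⟧ ρ ≡ ⟦ g ⟧ ρ)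
  Sg-≡ f g = Sg-resp (λ _ (p , q) → ≤-antisym p q) (λ _ p → ≤-reflexive p , ≤-reflexive (sym p))
               (Sg-∧ (Sg-≤ f g) (Sg-≤ g f))

  Sg-≢ : ∀ {N} (f g : Fun N) → Sg (λ ρ → ⟦ f ⟧ ρ ≢ ⟦ g ⟧ ρ)
  Sg-≢ f g = Sg-resp to from (Sg-∨ (Sg-≤ (sucᶠ f) g) (Sg-≤ (sucᶠ g) f))
    where
    to : ∀ ρ → ⟦ f ⟧ ρ < ⟦ g ⟧ ρ ⊎ ⟦ g ⟧ ρ < ⟦ f ⟧ ρ → ⟦ f ⟧ ρ ≢ ⟦ g ⟧ ρ
    to ρ (inj₁ p) = <⇒≢ p
    to ρ (inj₂ p) = >⇒≢ p
    from : ∀ ρ → ⟦ f ⟧ ρ ≢ ⟦ g ⟧ ρ → ⟦ f ⟧ ρ < ⟦ g ⟧ ρ ⊎ ⟦ g ⟧ ρ < ⟦ f ⟧ ρ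
    from ρ f≢g with <-cmp (⟦ f ⟧ ρ) (⟦ g ⟧ ρ)
    ... | tri< p _ _ = inj₁ p
    ... | tri≈ _ p _ = ⊥-elim (f≢g p)
    ... | tri> _ _ p = inj₂ p

  -- The successor values below the least zero are exactly the evidence that `ev-mu` demands.
  least : (f : ℕ → ℕ) (z : ℕ) → f z ≡ 0 → Σ ℕ λ k → f k ≡ 0 × (∀ j → j < k → Σ ℕ λ y → f j ≡ suc y)
  least f zero    eq = 0 , eq , λ _ ()
  least f (suc z) eq with f 0 in eq₀
  ... | zero  = 0 , eq₀ , λ _ ()
  ... | suc y with least (f ∘ suc) z eq
  ...   | k , eqₖ , below = suc k , eqₖ , λ { zero _ → y , eq₀ ; (suc j) (s≤s j<k) → below j j<k }

  -- Search for the least coded pair of a witness and a value passing the test, then return the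
  -- value; totality makes the search halt.
  Sg-uniformize : (R : Vec ℕ 1 → ℕ → Set) → Sg (λ ρ → R (tail ρ) (head ρ)) → (∀ e → Σ ℕ (R (e ∷ []))) →
                  Σ (Fun 1) λ f → ∀ e → R (e ∷ []) (⟦ f ⟧ (e ∷ []))
  Sg-uniformize R r total = record
      { ⟦_⟧  = λ { (e ∷ []) → snd (proj₁ (search e)) }
      ; code = comp (code (sndᶠ (v₀ {0}))) (mu (code t) ∷ [])
      ; ok   = λ { (e ∷ []) → ev-comp (ev-∷ (found e) ev-[]) (ok (sndᶠ (v₀ {0})) (proj₁ (search e) ∷ [])) } }
    , λ e → sound r (snd (proj₁ (search e)) ∷ e ∷ []) (fst (proj₁ (search e))) (proj₁ (proj₂ (search e)))
    where
    t : Fun 2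
    t = test r ∘ᶠ (fstᶠ v₀ ∷ᴹ sndᶠ v₀ ∷ᴹ drop)
    search : ∀ e → Σ ℕ λ k → ⟦ t ⟧ (k ∷ e ∷ []) ≡ 0 × (∀ j → j < k → Σ ℕ λ y → ⟦ t ⟧ (j ∷ e ∷ []) ≡ suc y)
    search e with complete (Sg-∃ {R = R} r) (e ∷ []) (total e)
    ... | z , eq = least (λ z → ⟦ t ⟧ (z ∷ e ∷ [])) z eq
    found : ∀ e → X ⊢ mu (code t) [ e ∷ [] ]⇓ proj₁ (search e)
    found e with search e
    ... | k , eq , below = ev-mu (subst (X ⊢ code t [ k ∷ e ∷ [] ]⇓_) eq (ok t (k ∷ e ∷ [])))
      λ j j<k → let (y , eqⱼ) = below j j<k in
        y , subst (X ⊢ code t [ j ∷ e ∷ [] ]⇓_) eqⱼ (ok t (j ∷ e ∷ []))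

-- Oracle evaluation and bigness are Σ₁

module _ (X : ℕ → ℕ) (n : ℕ) where

  -- The partial oracle given by X outside column n and by the coded string t inside it.
  Oracle : ℕ → ℕ → ℕ → Set
  Oracle t q a = (Σ ℕ λ k → q ≡ pair n k × Σ ℕ λ i → i + suc k ≡ fst t × snd t ‼ i ≡ a)
               ⊎ (OffColumn n q × X q ≡ a)

  open Computability X

  Sg-Oracle : ∀ {N} (t q a : Fun N) → Sg (λ ρ → Oracle (⟦ t ⟧ ρ) (⟦ q ⟧ ρ) (⟦ a ⟧ ρ))
  Sg-Oracle t q a = Sg-∨
    (Sg-∃ (Sg-∧ (Sg-≡ (wk q) (pairᶠ v₀))
      (Sg-∃ (Sg-∧ (Sg-≡ (v₀ +ᶠ sucᶠ v₁) (fstᶠ (wk (wk t)))) (Sg-≡ (sndᶠ (wk (wk t)) ‼ᶠ v₀) (wk (wk a)))))))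
    (Sg-∧ (Sg-∀< (sucᶠ q) (Sg-≢ (wk q) (pairᶠ v₀))) (Sg-≡ (orcᶠ q) a))
    where
    pairᶠ : ∀ {N} → Fun N → Fun N
    -- The column number is fixed, so `2 ^ n` enters as a numeral.
    pairᶠ k = const (2 ^ n) *ᶠ (const 2 *ᶠ k +ᶠ const 1)

  mutual
    -- Each clause of `Ev` uses only equations, oracle queries, conjunctions, and existential or
    -- bounded quantifiers, once vectors are packed and recursions replaced by traces. The string
    -- code `t` stays a variable because certificates range over strings.
    Sg-Ev : ∀ {N n} (t : Fun N) (c : Code n) (xs : Map N n) (y : Fun N) →
            Sg (λ ρ → Ev (Oracle (⟦ t ⟧ ρ)) c (⟦ xs ⟧* ρ) (⟦ y ⟧ ρ))
    Sg-Ev t zer xs y = Sg-≡ y (const 0)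
    Sg-Ev t succ xs y = Sg-≡ y (sucᶠ (headᴹ xs))
    Sg-Ev t (proj i) xs y = Sg-≡ y (lookupᴹ xs i)
    Sg-Ev t orc xs y = Sg-Oracle t (headᴹ xs) y
    Sg-Ev t (comp {m} c ds) xs y = Sg-resp
      (λ ρ (w , p) → unpack m w , p)
      (λ ρ (ys , p) → pack ys , subst (Q ρ) (sym (unpack-pack ys)) p)
      (Sg-∃ (Sg-∧ (Sg-Evs (wk t) ds (xs ∘ᴹ drop) (unpackᴹ m v₀)) (Sg-Ev (wk t) c (unpackᴹ m v₀) (wk y))))
      where
      Q : ∀ ρ → Vec ℕ m → Set
      Q ρ ys = Evs (Oracle (⟦ t ⟧ ρ)) ds (⟦ xs ⟧* ρ) ys × Ev (Oracle (⟦ t ⟧ ρ)) c ys (⟦ y ⟧ ρ)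
    Sg-Ev t (prec f g) xs y = Sg-resp
      (λ ρ (w , p) → Trace⇒Iter (⟦ headᴹ xs ⟧ ρ) w p)
      (λ ρ → Iter⇒Trace (⟦ headᴹ xs ⟧ ρ))
      (Sg-∃ (Sg-∧ (Sg-≡ (v₀ ‼ᶠ const 0) (wk y))
            (Sg-∧ (Sg-Ev (wk t) f (tailᴹ xs ∘ᴹ drop) (v₀ ‼ᶠ wk (headᴹ xs)))
                  (Sg-∀< (wk (headᴹ xs)) (Sg-∃ (Sg-∧ (Sg-≡ (v₁ +ᶠ sucᶠ v₀) (wk (wk (wk (headᴹ xs)))))
                    (Sg-Ev (wk (wk (wk t))) g
                      (v₀ ∷ᴹ wk v₁ ‼ᶠ sucᶠ v₁ ∷ᴹ tailᴹ xs ∘ᴹ drop ∘ᴹ drop ∘ᴹ drop) (wk v₁ ‼ᶠ v₁))))))))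
    Sg-Ev t (mu f) xs y = Sg-∧
      (Sg-Ev t f (y ∷ᴹ xs) (const 0))
      (Sg-∀< y (Sg-∃ (Sg-Ev (wk (wk t)) f (v₁ ∷ᴹ xs ∘ᴹ drop ∘ᴹ drop) (sucᶠ v₀))))

    Sg-Evs : ∀ {N n m} (t : Fun N) (ds : Vec (Code n) m) (xs : Map N n) (ys : Map N m) →
             Sg (λ ρ → Evs (Oracle (⟦ t ⟧ ρ)) ds (⟦ xs ⟧* ρ) (⟦ ys ⟧* ρ))
    Sg-Evs t []       xs ys = Sg-resp (λ _ _ → tt) (λ _ _ → refl) (Sg-≡ (const 0) (const 0))
    Sg-Evs t (d ∷ ds) xs ys = Sg-∧ (Sg-Ev t d xs (headᴹ ys)) (Sg-Evs t ds xs (tailᴹ ys))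

  -- For fixed `k` this unfolds into `k` nested existential quantifiers.
  Sg-Many : ∀ {N} {P : Vec ℕ N → ℕ → Set} → Sg (λ ρ → P (tail ρ) (head ρ)) →
            ∀ k (l : Fun N) → Sg (λ ρ → Many (P ρ) (⟦ l ⟧ ρ) k)
  Sg-Many p zero l = Sg-resp (λ _ _ → none) (λ _ _ → refl) (Sg-≡ (const 0) (const 0))
  Sg-Many {P = P} p (suc k) l = Sg-resp
    (λ ρ (x , l≤x , p , m) → more x l≤x p m)
    (λ { ρ (more x l≤x p m) → x , l≤x , p , m })
    (Sg-∃ (Sg-∧ (Sg-≤ (wk l) v₀) (Sg-∧ p
      (Sg-Many {P = λ ρ → P (tail ρ)} (Sg-sub p (v₀ ∷ᴹ drop ∘ᴹ drop)) k (sucᶠ v₀)))))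

  Sg-Big : ∀ {N} {A : Vec ℕ N → ℕ → Set} → Sg (λ ρ → A (tail ρ) (head ρ)) →
           ∀ k σ → Sg (λ ρ → Big k (A ρ ∘ enc) σ)
  Sg-Big {N} {A} a k σ = Sg-resp
    -- The root of the tree is at position 0, so the list length `m` serves as the bound for the
    -- induction.
    (λ ρ (w , m , root , 0<m , cert) → Certificate⇒Big (A ρ) cert m 0 ≤-refl 0<m σ root)
    complete′
    (Sg-∃ (Sg-∃ (Sg-∧ (Sg-≡ (v₁ ‼ᶠ const 0) (const (enc σ))) (Sg-∧ (Sg-≤ (const 1) v₀)
      (Sg-∀< v₀ (Sg-∨
        (Sg-sub a (wk v₁ ‼ᶠ v₀ ∷ᴹ drop ∘ᴹ drop ∘ᴹ drop))
        (Sg-Many (Sg-∃ (Sg-∧ (Sg-≤ (sucᶠ (wk v₁)) v₀) (Sg-∧ (Sg-≤ (sucᶠ v₀) (wk (wk v₁)))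
            (Sg-≡ (wk (wk (wk v₁)) ‼ᶠ v₀) (pushᶠ (wk (wk (wk v₁)) ‼ᶠ wk v₁) v₁)))))
          k (const 0))))))))
    where
    pushᶠ : ∀ {N} → Fun N → Fun N → Fun N
    pushᶠ t x = ⟪ sucᶠ (fstᶠ t) , ⟪ x , sndᶠ t ⟫ᶠ ⟫ᶠ
    complete′ : ∀ ρ → Big k (A ρ ∘ enc) σ →
                Σ ℕ λ w → Σ ℕ λ m → w ‼ 0 ≡ enc σ × 1 ≤ m × Certificate k (A ρ) w m
    complete′ ρ b with Big⇒Closed (A ρ) b
    ... | ts , c = encList (enc σ ∷ ts) , suc (length ts) , fst-⟪⟫ (enc σ) (encList ts) , s≤s z≤n ,
      Closed⇒Certificate (A ρ) (enc σ ∷ ts) c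

-- The forcing construction

module Construction (em : ExcludedMiddle 0ℓ) (h : ℕ → ℕ) where

  NoHDNR : (ℕ → ℕ) → Set
  NoHDNR X = ∀ e → ¬ IsHDNRVia h e X

  ¬∀⇒∃¬ : {A : Set} {P : A → Set} → ¬ (∀ x → P x) → Σ A (λ x → ¬ P x)
  ¬∀⇒∃¬ {A} {P} ¬all with em {Σ A (λ x → ¬ P x)}
  ... | yes p = p
  ... | no ¬p = ⊥-elim (¬all λ x → decide x)
    where
    decide : ∀ x → P x
    decide x with em {P x}
    ... | yes q = q
    ... | no ¬q = ⊥-elim (¬p (x , ¬q))

  -- The bound on `v` may be dropped from the conclusion: a value of at least `h x` will count as
  -- wrong anyway.
  ¬∃∀¬⇒∀∃ : {P : ℕ → ℕ → Set} → ¬ (Σ ℕ λ x → ∀ v → v < h x → ¬ P x v) → ∀ x → Σ ℕ (P x)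
  ¬∃∀¬⇒∀∃ {P} ¬p x with em {Σ ℕ (P x)}
  ... | yes q = q
  ... | no ¬q = ⊥-elim (¬p (x , λ v _ q → ¬q (v , q)))

  -- Were `B` big above every such `τ`, `big-concat` would make it big above `σ`.
  extend-into : ∀ {A B : Str → Set} {k σ} → ¬ Big k B σ → Big k A σ →
                Σ Str λ τ → σ ⊑ τ × A τ × ¬ Big k B τ
  extend-into {A} {B} {k} {σ} ¬b a with em {Σ Str λ τ → σ ⊑ τ × A τ × ¬ Big k B τ}
  ... | yes p = p
  ... | no ¬p = ⊥-elim (¬b (big-concat a λ τ σ⊑τ aτ → decide τ σ⊑τ aτ))
    where
    decide : ∀ τ → σ ⊑ τ → A τ → Big k B τ
    decide τ σ⊑τ aτ with em {Big k B τ}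
    ... | yes b = b
    ... | no ¬b = ⊥-elim (¬p (τ , σ⊑τ , aτ , ¬b))

  -- If `B` were big above every child, any `k` children would form a tree above `σ`.
  extend-by-one : ∀ {B : Str → Set} {k σ} → ¬ Big k B σ → Σ ℕ λ x → ¬ Big k B (x ∷ σ)
  extend-by-one {k = k} ¬b = ¬∀⇒∃¬ λ b → ¬b (node (many-all b 0 k))

  record Condition : Set₁ where
    constructor condition
    field
      stem  : Str
      bad   : Str → Set
      {k}   : ℕ
      small : ¬ Big k bad stem
  open Condition

  -- The stronger condition stands on the right; the branching numbers are not compared.
  record _≼_ (C D : Condition) : Set where
    field
      stem-⊑ : stem C ⊑ stem D
      bad-⊆  : ∀ τ → bad C τ → bad D τ
  open _≼_

  ≼-refl : ∀ {C} → C ≼ C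
  ≼-refl = record { stem-⊑ = ⊑-refl ; bad-⊆ = λ _ → id }

  ≼-trans : ∀ {C D E} → C ≼ D → D ≼ E → C ≼ E
  ≼-trans p q = record { stem-⊑ = ⊑-trans (stem-⊑ p) (stem-⊑ q) ; bad-⊆ = λ τ → bad-⊆ q τ ∘ bad-⊆ p τ }

  module _ (Forces : ℕ → ℕ → Str → Set) (Wrong : ℕ → ℕ → Set) where

    -- Either the stem forces a wrong value, or every string that forces a value below `h x` is bad
    -- and hence avoided by the generic.
    Decided : Condition → Set
    Decided C = (Σ ℕ λ x → Σ ℕ λ v → Wrong x v × Forces x v (stem C))
              ⊎ (Σ ℕ λ x → ∀ v → v < h x → ∀ τ → Forces x v τ → bad C τ)

    decide : (∀ k σ → (∀ x → Σ ℕ λ v → Big k (Forces x v) σ) →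
                Σ ℕ λ x → Σ ℕ λ v → Wrong x v × Big k (Forces x v) σ) →
             ∀ C → Σ Condition λ D → C ≼ D × Decided D
    decide big-wrong (condition σ B {k} small) with em {Σ ℕ λ x → ∀ v → v < h x → ¬ Big k (Forces x v) σ}
    -- The stem is kept; the new bad strings are paid for by a larger branching number.
    ... | yes (x , ¬big) = let (k′ , small′) = small-⋃ (h x) small ¬big in
        condition σ _ small′
      , record { stem-⊑ = ⊑-refl ; bad-⊆ = λ _ → inj₁ }
      , inj₂ (x , λ v v<h τ p → inj₂ (v , v<h , p))
    ... | no ¬allSmall =
      let (x , v , w , b) = big-wrong k σ (¬∃∀¬⇒∀∃ ¬allSmall)
          (τ , σ⊑τ , a , small′) = extend-into small b
      in condition τ B small′ , record { stem-⊑ = σ⊑τ ; bad-⊆ = λ _ → id } , inj₁ (x , v , w , a)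

  -- Stages run over all numbers, so `met` is vacuous when `e` codes no unary program. Strict growth
  -- of the stem makes the limit total.
  record Next (Met : Code 1 → Condition → Set) (e : ℕ) (C D : Condition) : Set where
    field
      ≼-next : C ≼ D
      longer : length (stem C) < length (stem D)
      met    : ∀ c → encode c ≡ e → Met c D
  open Next

  module _ (Met : Code 1 → Condition → Set) (meet : ∀ C c → Σ Condition λ D → C ≼ D × Met c D) where

    next : ∀ e C → Σ Condition (Next Met e C)
    next e C@(condition σ B {k} small) with extend-by-one small
    ... | x , small′ with em {Σ (Code 1) λ c → encode c ≡ e}
    ...   | no ¬code = condition (x ∷ σ) B small′ , record
            { ≼-next = record { stem-⊑ = ⊑-step ⊑-refl ; bad-⊆ = λ _ → id }
            ; longer = ≤-refl
            ; met    = λ c eq → ⊥-elim (¬code (c , eq)) }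
    ...   | yes (c , eq) with meet (condition (x ∷ σ) B small′) c
    ...     | D , C≼D , metD = D , record
            { ≼-next = ≼-trans {C} (record { stem-⊑ = ⊑-step ⊑-refl ; bad-⊆ = λ _ → id }) C≼D
            ; longer = ⊑-length (stem-⊑ C≼D)
            ; met    = λ d eq′ → subst (λ d → Met d D) (encode-injective c d (trans eq (sym eq′))) metD }

    stages : Condition → ℕ → Condition
    stages C zero    = C
    stages C (suc e) = proj₁ (next e (stages C e))

    stages-next : ∀ C e → Next Met e (stages C e) (stages C (suc e))
    stages-next C e = proj₂ (next e (stages C e))

  module Limit {Met : Code 1 → Condition → Set} (stage : ℕ → Condition)
               (stage-next : ∀ e → Next Met e (stage e) (stage (suc e))) where

    stage-mono : ∀ {m n} → m ≤′ n → stage m ≼ stage n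
    stage-mono ≤′-refl           = ≼-refl
    stage-mono (≤′-step {n} m≤n) = ≼-trans (stage-mono m≤n) (≼-next (stage-next n))

    prefix : ℕ → Str
    prefix = stem ∘ stage

    prefix-length : ∀ s → s ≤ length (prefix s)
    prefix-length zero    = z≤n
    prefix-length (suc s) = ≤-trans (s≤s (prefix-length s)) (longer (stage-next s))

    -- A bad stem would be a one-leaf tree, contradicting smallness.
    prefix-good : ∀ s → ¬ bad (stage s) (prefix s)
    prefix-good s = small (stage s) ∘ leaf

    -- Stage `suc k` is the first whose stem is guaranteed to reach position `k`, so the default of
    -- `entry` is never read.
    generic : ℕ → ℕ
    generic k = entry (prefix (suc k)) k

    entry-prefix : ∀ s {k} → k < length (prefix s) → entry (prefix s) k ≡ generic k
    entry-prefix s {k} k< with ≤-total s (suc k)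
    ... | inj₁ le = sym (entry-⊑ (stem-⊑ (stage-mono (≤⇒≤′ le))) k<)
    ... | inj₂ le = entry-⊑ (stem-⊑ (stage-mono (≤⇒≤′ le))) (prefix-length (suc k))

  module Approximation (X : ℕ → ℕ) (n : ℕ) (g : ℕ → ℕ) (prefix : ℕ → Str)
           (prefix-length : ∀ s → s ≤ length (prefix s))
           (entry-prefix : ∀ s {k} → k < length (prefix s) → entry (prefix s) k ≡ g k)
           (Y : ℕ → ℕ) (Y-in : ∀ k → Y (pair n k) ≡ g k) (Y-off : ∀ q → OffColumn n q → Y q ≡ X q) where

    oracle-sound : ∀ s q a → Oracle X n (enc (prefix s)) q a → Y q ≡ a
    oracle-sound s q a (inj₁ (k , refl , i , eq , ent)) = begin
      Y (pair n k)             ≡⟨ Y-in k ⟩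
      g k                      ≡⟨ entry-prefix s (≤-trans (m≤n+m (suc k) i) (≤-reflexive eq′)) ⟨
      entry (prefix s) k       ≡⟨ snd-enc (prefix s) i k eq′ ⟨
      snd (enc (prefix s)) ‼ i ≡⟨ ent ⟩
      a                        ∎
      where
      open ≡-Reasoning
      eq′ : i + suc k ≡ length (prefix s)
      eq′ = trans eq (fst-enc (prefix s))
    oracle-sound s q a (inj₂ (off , eq)) = trans (Y-off q off) eq

    -- A query at position `k` of the new column is answered from stage `suc k` on; all others are
    -- answered by `X` at once.
    oracle-complete : ∀ q → Eventually (λ s → Oracle X n (enc (prefix s)) q (Y q))
    oracle-complete q with em {InColumn n q}
    ... | no ¬in = 0 , λ _ _ → let off = λ k _ eq → ¬in (k , eq) in inj₂ (off , sym (Y-off q off))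
    ... | yes (k , refl) = suc k , λ s 1+k≤s →
      let 1+k≤len = ≤-trans 1+k≤s (prefix-length s)
          eq      = m∸n+n≡m 1+k≤len
      in inj₁ (k , refl , length (prefix s) ∸ suc k , trans eq (sym (fst-enc (prefix s)))
              , trans (snd-enc (prefix s) _ k eq) (trans (entry-prefix s 1+k≤len) (sym (Y-in k))))

  module Column (X : ℕ → ℕ) (n : ℕ) (X-noHDNR : NoHDNR X) where

    open Computability X

    Forces : Code 1 → ℕ → ℕ → Str → Set
    Forces c x v τ = Ev (Oracle X n (enc τ)) c (x ∷ []) v

    search : ∀ c k σ → (∀ x → Σ ℕ λ v → Big k (Forces c x v) σ) →
             Σ (Fun 1) λ f → ∀ x → Big k (Forces c x (⟦ f ⟧ (x ∷ []))) σ
    search c k σ = Sg-uniformize (λ ρ v → Big k (Forces c (head ρ) v) σ)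
      (Sg-Big X n {A = λ ρ t → Ev (Oracle X n t) c (head (tail ρ) ∷ []) (head ρ)}
        -- The variables are, in order, the string, the value and the argument.
        (Sg-Ev X n v₀ c (wk v₁ ∷ᴹ []ᴹ) v₁) k σ)

    -- These are the values that no `h`-DNR function takes at `x`.
    Wrong : ℕ → ℕ → Set
    Wrong x v = h x ≤ v ⊎ Φ x [ ∅ ] x ⇓ v

    -- Otherwise `f` would be an `h`-DNR function computed by `X`.
    wrong-value : (f : Fun 1) → Σ ℕ λ x → Wrong x (⟦ f ⟧ (x ∷ []))
    wrong-value f with em {Σ ℕ λ x → Wrong x (⟦ f ⟧ (x ∷ []))}
    ... | yes p = p
    ... | no ¬p = ⊥-elim (X-noHDNR (encode (code f))
            ( (λ x → ⟦ f ⟧ (x ∷ [])) , (λ x → code f , refl , ok f (x ∷ []))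
            , (λ { x y p refl → ¬p (x , inj₂ p) }) , λ x → ≰⇒> λ hx≤ → ¬p (x , inj₁ hx≤)))

    big-wrong : ∀ c k σ → (∀ x → Σ ℕ λ v → Big k (Forces c x v) σ) →
                Σ ℕ λ x → Σ ℕ λ v → Wrong x v × Big k (Forces c x v) σ
    big-wrong c k σ total = let (f , f-big) = search c k σ total ; (x , w) = wrong-value f in
      x , ⟦ f ⟧ (x ∷ []) , w , f-big x

    Met : Code 1 → Condition → Set
    Met c = Decided (Forces c) Wrong

    meet : ∀ C c → Σ Condition λ D → C ≼ D × Met c D
    meet C c = decide (Forces c) Wrong (big-wrong c) C

    NotDNR : Str → Set
    NotDNR τ = Σ ℕ λ k → k < length τ × Φ k [ X ] k ⇓ entry τ k

    NotDNR-last : ∀ x τ → NotDNR (x ∷ τ) → NotDNR τ ⊎ Φ (length τ) [ X ] (length τ) ⇓ x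
    NotDNR-last x τ (k , k<1+len , p) with m≤n⇒m<n∨m≡n (s≤s⁻¹ k<1+len)
    ... | inj₁ k<len = inj₁ (k , k<len , subst (Φ k [ X ] k ⇓_) (entry-init x τ k<len) p)
    ... | inj₂ refl  = inj₂ (subst (Φ k [ X ] k ⇓_) (entry-last x τ) p)

    -- A diagonal computation excludes at most one value, so two children suffice.
    NotDNR-big₂ : ∀ {τ} → Big 2 NotDNR τ → NotDNR τ
    NotDNR-big₂ (leaf p) = p
    NotDNR-big₂ {τ} (node (more x _ b (more y x<y b′ none)))
      with NotDNR-last x τ (NotDNR-big₂ b) | NotDNR-last y τ (NotDNR-big₂ b′)
    ... | inj₁ p | _      = p
    ... | inj₂ _ | inj₁ p = p
    ... | inj₂ p | inj₂ q = ⊥-elim (<⇒≢ x<y (Φ-deterministic p q))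

    C₀ : Condition
    C₀ = condition [] NotDNR {2} λ b → n≮0 (proj₁ (proj₂ (NotDNR-big₂ b)))

    module _ (stage : ℕ → Condition) (stage-next : ∀ e → Next Met e (stage e) (stage (suc e)))
             (bad₀ : ∀ τ → NotDNR τ → bad (stage 0) τ) where

      open Limit {Met} stage stage-next

      -- A violation at `x` already shows in the stem of stage `suc x`, which would then be bad from
      -- the start.
      generic-DNR : DNR^ generic X
      generic-DNR x y p refl = prefix-good (suc x)
        (bad-⊆ (stage-mono (z≤′n {suc x})) _ (bad₀ _ (x , prefix-length (suc x) , p)))

      module _ (Y : ℕ → ℕ) (Y-in : ∀ k → Y (pair n k) ≡ generic k)
               (Y-off : ∀ q → OffColumn n q → Y q ≡ X q) where

        open Approximation X n generic prefix prefix-length entry-prefix Y Y-in Y-off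

        generic-noHDNR : NoHDNR Y
        -- Evaluating at 0 serves only to learn that `e` codes a program `c`.
        generic-noHDNR e (H , computes , dnr , bounded) with computes 0
        ... | c , encode≡e , _ with met (stage-next e) c encode≡e
        ...   | inj₁ (x , v , wrong , forced) = refute wrong
          where
          H≡v : H x ≡ v
          H≡v = Φ-deterministic (computes x) (c , encode≡e , Ev⇒⇓ (oracle-sound (suc e)) c _ v forced)
          refute : ¬ Wrong x v
          refute (inj₁ h≤v) = <⇒≱ (bounded x) (≤-trans h≤v (≤-reflexive (sym H≡v)))
          refute (inj₂ p)   = dnr x v p H≡v
        ...   | inj₂ (x , forced) with computes x
        ...     | d , encode≡e′ , p with encode-injective d c (trans encode≡e′ (sym encode≡e))
        ...       | refl with ⇓⇒Ev {P = λ s → Oracle X n (enc (prefix s))} oracle-complete c p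
        ...         | m , ev = prefix-good s (bad-⊆ (stage-mono (≤⇒≤′ (m≤n⊔m m (suc e)))) _
                                 (forced (H x) (bounded x) (prefix s) (ev s (m≤m⊔n m (suc e)))))
          where
          -- Late enough both for the stem to carry out the computation and for the bad set of stage
          -- `suc e` to be in force.
          s = m ⊔ suc e

    column-exists : Σ (ℕ → ℕ) λ g → DNR^ g X ×
      (∀ Y → (∀ k → Y (pair n k) ≡ g k) → (∀ q → OffColumn n q → Y q ≡ X q) → NoHDNR Y)
    column-exists = Limit.generic {Met} stage stage-next
                  , generic-DNR stage stage-next (λ _ → id) , generic-noHDNR stage stage-next (λ _ → id)
      where
      stage = stages Met meet C₀
      stage-next = stages-next Met meet C₀

  -- Iteration over all columns

  ∅-noHDNR : NoHDNR ∅
  -- `H` agrees with the diagonal at its own index `e`.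
  ∅-noHDNR e (H , computes , dnr , _) = dnr e (H e) (computes e) refl

  override : ℕ → (X g : ℕ → ℕ) → ℕ → ℕ
  override n X g q with em {InColumn n q}
  ... | yes (k , _) = g k
  ... | no _        = X q

  override-in : ∀ n X g k → override n X g (pair n k) ≡ g k
  override-in n X g k with em {InColumn n (pair n k)}
  ... | yes (k′ , eq) = cong g (sym (proj₂ (pair-injective n n k k′ eq)))
  ... | no ¬in        = ⊥-elim (¬in (k , refl))

  override-off : ∀ n X g q → OffColumn n q → override n X g q ≡ X q
  override-off n X g q off with em {InColumn n q}
  ... | yes (k , refl) = ⊥-elim (off k (m≤n⇒m≤1+n (k<pair n k)) refl)
  ... | no _           = refl

  module Columns (column : ∀ X n → NoHDNR X → Σ (ℕ → ℕ) λ g → DNR^ g X ×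
    (∀ Y → (∀ k → Y (pair n k) ≡ g k) → (∀ q → OffColumn n q → Y q ≡ X q) → NoHDNR Y)) where

    -- The proof travels with the join because the next column is built from it.
    join : ℕ → Σ (ℕ → ℕ) NoHDNR
    join zero    = ∅ , ∅-noHDNR
    join (suc n) = let (X , p) = join n ; (g , _ , avoids) = column X n p in
      override n X g , avoids (override n X g) (override-in n X g) (override-off n X g)

    col : ℕ → ℕ → ℕ
    col n = proj₁ (column (proj₁ (join n)) n (proj₂ (join n)))

    join-below : ∀ {n m} k → n <′ m → proj₁ (join m) (pair n k) ≡ col n k
    join-below {n} k ≤′-refl = override-in n (proj₁ (join n)) (col n) k
    join-below {n} k (≤′-step {m} n<m) = trans
      (override-off m (proj₁ (join m)) (col m) (pair n k)
        (λ k′ _ eq → <⇒≢ (≤′⇒≤ n<m) (proj₁ (pair-injective n m k k′ eq))))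
      (join-below k n<m)

    join-above : ∀ {n} m k → m ≤ n → proj₁ (join m) (pair n k) ≡ 0
    join-above zero k _ = refl
    join-above {n} (suc m) k m<n = trans
      (override-off m (proj₁ (join m)) (col m) (pair n k)
        (λ k′ _ eq → >⇒≢ m<n (proj₁ (pair-injective n m k k′ eq))))
      (join-above m k (<⇒≤ m<n))

    join-0 : ∀ m → proj₁ (join m) 0 ≡ 0
    join-0 zero    = refl
    join-0 (suc m) = trans
      (override-off m (proj₁ (join m)) (col m) 0 (λ k _ eq → pair≢0 m k (sym eq))) (join-0 m)

    G : ℕ → ℕ
    G q with em {Σ ℕ λ n → InColumn n q}
    ... | yes (n , k , _) = col n k
    -- Only 0 lies in no column.
    ... | no _            = 0

    G-pair : ∀ n k → G (pair n k) ≡ col n k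
    G-pair n k with em {Σ ℕ λ n′ → InColumn n′ (pair n k)}
    ... | no ¬in = ⊥-elim (¬in (n , k , refl))
    ... | yes (n′ , k′ , eq) with pair-injective n n′ k k′ eq
    ...   | refl , refl = refl

    -- The valuation of a nonzero `q` is its column number, so the test in `initJoin` asks whether
    -- that column has already been written.
    initJoin-G : ∀ m q → initJoin m G q ≡ proj₁ (join m) q
    initJoin-G m zero = sym (join-0 m)
    initJoin-G m (suc q) with pair-surjective (suc q) (λ ())
    ... | n , k , eq with v2 (suc q) | trans (cong v2 eq) (v2-pair n k)
    ...   | .n | refl with n <ᵇ m in lt
    ...     | true  = trans (cong G eq) (trans (G-pair n k) (sym (trans (cong (proj₁ (join m)) eq)
                        (join-below k (≤⇒≤′ (<ᵇ⇒< n m (subst T (sym lt) tt)))))))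
    ...     | false = sym (trans (cong (proj₁ (join m)) eq)
                        (join-above m k (≮⇒≥ λ n<m → subst T lt (<⇒<ᵇ n<m))))

    -- Every column is DNR relative to the join of the earlier ones; the even columns are the
    -- instances required.
    G-relativelyDNR : RelativelyDNR G
    G-relativelyDNR x y (c , eq , p) =
      proj₁ (proj₂ (column (proj₁ (join (2 * y))) (2 * y) (proj₂ (join (2 * y))))) x _
        (c , eq , ⇓-cong (initJoin-G (2 * y)) p) (sym (G-pair (2 * y) x))

    G-noHDNR : ∀ e i → ¬ IsHDNRVia h e (initJoin (suc i) G)
    G-noHDNR e i (H , computes , dnr) = proj₂ (join (suc i)) e
      (H , (λ x → let (c , eq , p) = computes x in c , eq , ⇓-cong (initJoin-G (suc i)) p) , dnr)

theorem1p5 : ExcludedMiddle 0ℓ → (h : ℕ → ℕ) → Recursive h →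
    Σ (ℕ → ℕ) λ G → RelativelyDNR G ×
      ((e i : ℕ) → ¬ IsHDNRVia h e (initJoin (suc i) G))
theorem1p5 em h _ = G , G-relativelyDNR , G-noHDNR
  where
  open Construction em h
  open Columns Column.column-exists
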